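{- Let $t\ge 2$, $N=t+2$, and let $\lambda$ be a partition with at most $N$ parts. Let $\Phi_t(\lambda;z)=s_\lambda(1,\zeta,\dots,\zeta^{t-1},z,z^{ -1})$ with $\zeta=e^{2\pi i/t}$. (i) If $n_i(\lambda)=0$ for some $i$, then $\Phi_t(\lambda;z)=0$. (ii) Otherwise either exactly two residue classes have $n_i=2$ (and all others $n_i=1$), or exactly one has $n_i=3$ (and all others $n_i=1$). Let $r_A\le r_B$ be the residues involved and let $A=\{a_1>a_2\}$, $B=\{b_1>b_2\}$ be, in the first case, the parts of $\beta(\lambda)$ in the classes $r_A$ and $r_B$, and in the second case the two overlapping pairs $A=\{p,q\}$, $B=\{q,r\}$ of the class $\{p>q>r\}$ (so $r_A=r_B$). Set $$d_1=a_1-a_2,\quad d_2=b_1-b_2,\quad \tilde d_3=a_1+a_2-b_1-b_2,\quad d_3=|\tilde d_3|.$$ If $\tilde d_3=0$ then $\Phi_t(\lambda;z)=0$. Otherwise, with $z=e^\theta$, $$\Phi_t(\lambda;z)=\varepsilon_\lambda\,\frac{\sinh(d_1\theta/2)\,\sinh(d_2\theta/2)\,\sinh(d_3\theta/2)}{\sinh^2(t\theta/2)\,\sinh\theta},$$ where, writing $j_{A_1}$ and $j_{B_1}$ for the columns carrying $a_1$ and $b_1$ (i.e. $\beta_{j_{A_1}}=a_1$, $\beta_{j_{B_1}}=b_1$), $S=\{1,\dots,N\}\setminus\{j_{A_1},j_{B_1}\}$, and $b_S$ for the word of residues $\beta_j \bmod t$, $j\in S$, read in increasing order of $j$, $$\varepsilon_\lambda=(-1)^{\,t+\binom{N+1}{2}}\,(-1)^{\,j_{A_1}+j_{B_1}+\operatorname{inv}(b_S)}\,\operatorname{sgn}(a_1-b_1)\,\operatorname{sgn}(\tilde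 d_3)\in\{\pm1\}.$$
   Context: For $\lambda=(\lambda_1\ge\dots\ge\lambda_N\ge0)$ (padded with zeros to $N$ parts) the beta set is $\beta(\lambda)=(\beta_1>\beta_2>\dots>\beta_N\ge0)$ with $\beta_j=\lambda_j+N-j$; the index $j\in\{1,\dots,N\}$ is called the column of $\beta_j$. For $0\le i\le t-1$, $n_i(\lambda)$ is the number of $j$ with $\beta_j\equiv i\pmod t$; since $\sum_i n_i=t+2$, when no $n_i$ vanishes only the two profiles in (ii) can occur. $\operatorname{inv}(b)$ is the number of inversions of a word $b$ of integers (pairs of positions $p<q$ with $b_p>b_q$), residues being taken in $\{0,\dots,t-1\}$. $s_\lambda$ is the Schur polynomial in $N$ variables. The displayed identity is read as an identity of rational functions (both sides are Laurent polynomials in $z$ after cancellation). -}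

module Defs where

open import Algebra.Apartness.Bundles using (HeytingCommutativeRing; HeytingField)
open import Algebra.Bundles using (CommutativeRing; Semiring)
open import Data.Fin as Fin using (Fin; toℕ)
import Data.Fin.Properties as Fin
open import Data.Integer as ℤ using (ℤ; +_; -[1+_]; +[1+_]; 0ℤ; 1ℤ; -1ℤ)
open import Data.List as List using (List; []; _∷_; length; filter; allFin)
open import Data.Nat as ℕ using (ℕ; zero; suc; _∸_; _<_; _>_; _≥_; NonZero)
open import Data.Nat.Combinatorics using (_C_)
open import Data.Nat.DivMod using (_mod_)
open import Data.Product using (proj₁; _×_)
open import Data.Vec as Vec using (Vec; []; _∷_; lookup; tabulate; init; last)
open import Data.Vec.Relation.Unary.Linked using (Linked)
open import Relation.Binary.PropositionalEquality using (_≡_; _≢_)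
import Level
open import Relation.Nullary.Decidable using (_×-dec_; ¬?)

-- A partition with at most n parts, padded with zeros to exactly n parts.
IsPartition : ∀ {n} → Vec ℕ n → Set
IsPartition = Linked _≥_

-- [ lo ⋯ hi ] = lo, lo + 1, …, hi, for lo ≤ hi.
[_⋯_] : ℕ → ℕ → List ℕ
[ lo ⋯ hi ] = List.applyUpTo (lo ℕ.+_) (suc (hi ∸ lo))

-- For λ₁ ≥ … ≥ λₙ₊₁, the μ with λ₁ ≥ μ₁ ≥ λ₂ ≥ μ₂ ≥ … ≥ μₙ ≥ λₙ₊₁, i.e. the
-- partitions with at most n parts such that λ/μ is a horizontal strip.
interlacing : ∀ {n} → Vec ℕ (suc n) → List (Vec ℕ n)
interlacing (_ ∷ [])     = [] ∷ []
interlacing (a ∷ b ∷ ps) =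
  List.cartesianProductWith _∷_ [ b ⋯ a ] (interlacing (b ∷ ps))

inv : ∀ {m} → List (Fin m) → ℕ
inv []       = 0
inv (b ∷ bs) = length (filter (Fin._<? b) bs) ℕ.+ inv bs

sgn : ℤ → ℤ
sgn +[1+ _ ] = 1ℤ
sgn (+ 0)    = 0ℤ
sgn -[1+ _ ] = -1ℤ

-- The columns 1, …, N are represented by Fin N, which counts from 0.
module BetaSet (t : ℕ) .{{_ : NonZero t}} (lam : Vec ℕ (t ℕ.+ 2)) where

  N : ℕ
  N = t ℕ.+ 2

  column : Fin N → ℕ
  column j = suc (toℕ j)

  β : Fin N → ℕ
  β j = lookup lam j ℕ.+ (N ∸ column j)

  residue : Fin N → Fin t
  residue j = β j mod t

  n : Fin t → ℕ
  n i = length (filter (λ j → residue j Fin.≟ i) (allFin N))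

  -- Pairs A₁ A₂ B₁ B₂: the columns A₁, A₂, B₁, B₂ carry a₁ > a₂ and b₁ > b₂.
  data Pairs : (A₁ A₂ B₁ B₂ : Fin N) → Set where
    twoDoubles : ∀ {A₁ A₂ B₁ B₂} (rA rB : Fin t) → rA Fin.< rB →
                 n rA ≡ 2 → n rB ≡ 2 →
                 (∀ i → i ≢ rA → i ≢ rB → n i ≡ 1) →
                 residue A₁ ≡ rA → residue A₂ ≡ rA → β A₁ > β A₂ →
                 residue B₁ ≡ rB → residue B₂ ≡ rB → β B₁ > β B₂ →
                 Pairs A₁ A₂ B₁ B₂
    oneTriple  : ∀ {P Q R} (r : Fin t) →
                 n r ≡ 3 →
                 (∀ i → i ≢ r → n i ≡ 1) →
                 residue P ≡ r → residue Q ≡ r → residue R ≡ r →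
                 β P > β Q → β Q > β R →
                 Pairs P Q Q R

  module Invariants (A₁ A₂ B₁ B₂ : Fin N) where

    -- Truncated subtraction is exact here: a₁ > a₂ and b₁ > b₂.
    d₁ d₂ d₃ : ℕ
    d̃₃ : ℤ
    d₁ = β A₁ ∸ β A₂
    d₂ = β B₁ ∸ β B₂
    d̃₃ = + (β A₁ ℕ.+ β A₂) ℤ.- + (β B₁ ℕ.+ β B₂)
    d₃ = ℤ.∣ d̃₃ ∣

    b-S : List (Fin t)
    b-S = List.map residue
      (filter (λ j → ¬? (j Fin.≟ A₁) ×-dec ¬? (j Fin.≟ B₁)) (allFin N))

    ε : ℤ
    ε = -1ℤ ℤ.^ (t ℕ.+ (suc N C 2))
        ℤ.* -1ℤ ℤ.^ (column A₁ ℕ.+ column B₁ ℕ.+ inv b-S)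
        ℤ.* sgn (+ β A₁ ℤ.- + β B₁)
        ℤ.* sgn d̃₃

-- The base field is kept abstract: F may be ℂ, with z and θ numbers, or the
-- rational function field ℂ(w) with w = e^{θ/2}, in which an equation between
-- elements is an identity of rational functions.
module OverField {c ℓ₁ ℓ₂} (F : HeytingField c ℓ₁ ℓ₂) where

  open HeytingField F
  open import Algebra.Definitions.RawSemiring
    (Semiring.rawSemiring (CommutativeRing.semiring
      (HeytingCommutativeRing.commutativeRing heytingCommutativeRing)))
    using (_^_) renaming (_×_ to _·_) public

  CharacteristicZero : Set ℓ₂
  CharacteristicZero = ∀ k → (suc k · 1#) # 0#

  record IsPrimitiveRoot (t : ℕ) (ζ : Carrier) : Set (ℓ₁ Level.⊔ ℓ₂) where
    field
      ζ^t≈1 : ζ ^ t ≈ 1#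
      ζ^k#1 : ∀ k → 0 < k → k < t → (ζ ^ k) # 1#

  -- The library's witness inverts x - 0#, which is equal to x.
  recip : ∀ {x} → x # 0# → Carrier
  recip x#0 = proj₁ (#⇒invertible x#0)

  fromℤ : ℤ → Carrier
  fromℤ (+ k)    = k · 1#
  fromℤ -[1+ k ] = - (suc k · 1#)

  sumOver : ∀ {a} {A : Set a} → List A → (A → Carrier) → Carrier
  sumOver as f = List.foldr (λ a acc → f a + acc) 0# as

  -- The Schur polynomial s_λ(x₁, …, xₙ) = Σ_T x^T over the semistandard
  -- tableaux T of shape λ with entries in {1, …, n}. A tableau is given by its
  -- chain of shapes ∅ = λ⁽⁰⁾ ⊆ λ⁽¹⁾ ⊆ … ⊆ λ⁽ⁿ⁾ = λ, where λ⁽ᵏ⁾ is the shape of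
  -- the entries ≤ k: it has at most k parts, each λ⁽ᵏ⁾/λ⁽ᵏ⁻¹⁾ is a horizontal
  -- strip, and the exponent of x_k in x^T is |λ⁽ᵏ⁾| - |λ⁽ᵏ⁻¹⁾|. The sum over
  -- chains is taken from the top, μ being λ⁽ⁿ⁻¹⁾.
  schur : ∀ {n} → Vec ℕ n → Vec Carrier n → Carrier
  schur {zero}  _   _ = 1#
  schur {suc n} lam x =
    sumOver (interlacing lam) λ μ →
      last x ^ (Vec.sum lam ∸ Vec.sum μ) * schur μ (init x)

  Φ : ∀ t (lam : Vec ℕ (t ℕ.+ 2)) (ζ z : Carrier) → z # 0# → Carrier
  Φ t lam ζ z z#0 =
    schur lam (tabulate {n = t} (λ i → ζ ^ toℕ i) Vec.++ (z ∷ recip z#0 ∷ []))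

  -- With w = e^{θ/2}, so that w² = e^θ, sinhHalf k is sinh(kθ/2).
  module Hyperbolic (char0 : CharacteristicZero) {w : Carrier} (w#0 : w # 0#) where

    sinhHalf : ℕ → Carrier
    sinhHalf k = (w ^ k - recip w#0 ^ k) * recip (char0 1)

    denominator : ℕ → Carrier
    denominator t = sinhHalf t ^ 2 * sinhHalf 2

{-# OPTIONS --safe #-}

-- By the branching rule, s_λ · Δ is the alternant det(x_i^β_j), with Δ the Vandermonde
-- determinant. Take z⁻¹, z and the t-th roots of unity as rows, and move the columns of
-- a₁ and b₁ to the front. Subtracting the columns of a₂ and b₂ from them makes them
-- vanish on the roots of unity, because there x^k depends only on k mod t. The alternant
-- is thus a 2 × 2 block in z⁻¹ and z, which factors as
--   (z^-(b₁+b₂) - z^-(a₁+a₂)) (z^a₁ - z^a₂) (z^b₁ - z^b₂),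
-- times the alternant of the other columns at the roots of unity. That one depends only
-- on the word of residues: it is 0 if a residue is missing, and otherwise it is
-- (-1)^inv(b_S) times its value at the sorted word. For λ = 0 the same computation, with
-- a₁, a₂, b₁, b₂ = t + 1, 1, t, 0, gives Δ, and the quotient of the two blocks is the
-- quotient of products of sinh.
module Submission where

open import Defs
open import Algebra.Apartness.Bundles using (HeytingField; HeytingCommutativeRing)
open import Algebra.Bundles using (CommutativeRing)
import Algebra.Properties.Semiring.Exp as Exp
import Algebra.Properties.CommutativeSemiring.Exp as CommExp
import Algebra.Properties.Ring as RingProperties
import Algebra.Properties.Semiring.Mult.TCOptimised as Mult
import Algebra.Solver.Ring
open import Algebra.Solver.Ring.AlmostCommutativeRing
  using (fromCommutativeRing; _-Raw-AlmostCommutative⟶_)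
open import Data.Fin as Fin using (Fin; toℕ)
import Data.Fin.Properties as Fin
open import Data.Integer as ℤ using (ℤ; +_; -[1+_]; 0ℤ; 1ℤ; -1ℤ)
import Data.Integer.Properties as ℤ
open import Data.List as List using (List; []; _∷_; _++_; length; map; filter; allFin)
import Data.List.Properties as List
import Data.List.Membership.DecPropositional as DecMembership
open import Data.List.Membership.Propositional using (_∈_)
open import Data.List.Membership.Propositional.Properties as ∈ using (∈-∃++)
open import Data.List.Relation.Binary.Permutation.Propositional as Perm using (_↭_)
import Data.List.Relation.Binary.Permutation.Propositional.Properties as Perm
import Data.List.Relation.Binary.Permutation.Setoid.Properties as SetoidPerm
open import Data.List.Relation.Binary.Pointwise as Pointwise using (Pointwise; []; _∷_)
open import Data.List.Relation.Unary.All as All using (All; []; _∷_)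
import Data.List.Relation.Unary.All.Properties as All
open import Data.List.Relation.Unary.AllPairs as AllPairs using (AllPairs; []; _∷_)
import Data.List.Relation.Unary.AllPairs.Properties as AllPairs
open import Data.List.Relation.Unary.Any as Any using (here; there)
open import Data.List.Relation.Unary.Unique.Propositional using (Unique)
open import Data.Maybe using (Maybe; just; nothing)
open import Data.Nat as ℕ using (ℕ; zero; suc; _≤_; _<_; _>_; _∸_; z≤n; s≤s; NonZero)
open import Data.Nat.Combinatorics as ℕ using (_C_)
open import Data.Nat.DivMod as ℕ using (_mod_; _%_; _/_)
import Data.Nat.Properties as ℕ
import Data.Nat.Solver
open import Data.Product using (_×_; _,_; ∃-syntax; proj₁; proj₂)
open import Data.Sum using (_⊎_; inj₁; inj₂)
open import Data.Unit using (tt)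
open import Data.Vec as Vec using (Vec; []; _∷_; lookup)
import Data.Vec.Properties as Vec
open import Data.Vec.Relation.Unary.All as VecAll using ([]; _∷_)
import Data.Vec.Relation.Unary.All.Properties as VecAll
open import Data.Vec.Relation.Unary.Linked as Linked using ([]; [-]; _∷_)
import Data.Vec.Relation.Unary.Linked.Properties as Linked
open import Function using (_∘_; id; case_of_)
import Level
import Relation.Binary.Reasoning.Setoid as SetoidReasoning
open import Relation.Binary using (DecidableEquality; Rel; Symmetric; tri<; tri≈; tri>)
open import Relation.Binary.PropositionalEquality as ≡ using (_≡_; _≢_)
open import Relation.Nullary using (yes; no; ¬_; contradiction)
open import Relation.Nullary.Decidable using (_×-dec_; ¬?)

-- The obstacle is the division by Δ. It is 0 where z^t = 1 or z² = 1, yet the vanishing statements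
-- are claimed there too, and equality in a Heyting field cannot be decided, so there is no case
-- distinction on z. Only the alternant at the roots of unity is cancelled at every z: it does not
-- involve z, and primitivity of ζ makes it invertible. This gives a relation between the two 2 × 2
-- blocks at every z. The sinh formula follows because its denominator is apart from 0. Vanishing is
-- obtained at integers z ≥ 2 first, and then everywhere because a Laurent polynomial with that many
-- zeros is 0 in characteristic 0.
--
-- In the sign, t + C(t+3,2) has the parity of 1 + C(t,2). Here C(t,2) counts the inversions of t -
-- 1, ..., 0, the residues left over for λ = 0. The 1 comes from moving the columns of a₁ and b₁ to
-- the front: up to parity this takes j_A₁ + j_B₁ adjacent swaps, or one less when a₁ > b₁, and
-- sgn(a₁ - b₁) tells these cases apart up to a global sign.

-- Ring normalisation with integer coefficients

module IntegerCoefficients {c ℓ} (R : CommutativeRing c ℓ) where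

  open CommutativeRing R
  open RingProperties ring
  open Mult semiring renaming (_×_ to _·_)
  open SetoidReasoning setoid

  -- The optimised multiple makes `1 · 1#` compute to `1#`, so that the constants of the solver
  -- match `0#` and `1#` on the nose.
  ⟦_⟧ℤ : ℤ → Carrier
  ⟦ + k ⟧ℤ      = k · 1#
  ⟦ -[1+ k ] ⟧ℤ = - (suc k · 1#)

  -‿homo : ∀ i → ⟦ ℤ.- i ⟧ℤ ≈ - ⟦ i ⟧ℤ
  -‿homo (+ zero)  = sym -0#≈0#
  -‿homo (+ suc k) = refl
  -‿homo -[1+ k ]  = sym (-‿involutive _)

  ⊖-homo : ∀ m n → ⟦ m ℤ.⊖ n ⟧ℤ ≈ m · 1# - n · 1#
  ⊖-homo m       zero    = sym (trans (+-congˡ -0#≈0#) (+-identityʳ _))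
  ⊖-homo zero    (suc n) = sym (+-identityˡ _)
  ⊖-homo (suc m) (suc n) = begin
    ⟦ suc m ℤ.⊖ suc n ⟧ℤ              ≡⟨ ≡.cong ⟦_⟧ℤ (ℤ.[1+m]⊖[1+n]≡m⊖n m n) ⟩
    ⟦ m ℤ.⊖ n ⟧ℤ                      ≈⟨ ⊖-homo m n ⟩
    m · 1# - n · 1#                   ≈⟨ +-congʳ (+-identityˡ _) ⟨
    0# + m · 1# - n · 1#              ≈⟨ +-congʳ (+-congʳ (-‿inverseʳ 1#)) ⟨
    1# - 1# + m · 1# - n · 1#         ≈⟨ +-congʳ (trans (+-assoc _ _ _) (trans (+-congˡ (+-comm _ _)) (sym (+-assoc _ _ _)))) ⟩
    1# + m · 1# - 1# - n · 1#         ≈⟨ +-assoc _ _ _ ⟩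
    1# + m · 1# + (- 1# - n · 1#)     ≈⟨ +-congˡ (-‿+-comm _ _) ⟩
    1# + m · 1# - (1# + n · 1#)       ≈⟨ +-cong (1+× m 1#) (-‿cong (1+× n 1#)) ⟨
    suc m · 1# - suc n · 1#           ∎

  +-homo : ∀ i j → ⟦ i ℤ.+ j ⟧ℤ ≈ ⟦ i ⟧ℤ + ⟦ j ⟧ℤ
  +-homo (+ m)    (+ n)    = ×-homo-+ 1# m n
  +-homo (+ m)    -[1+ n ] = ⊖-homo m (suc n)
  +-homo -[1+ m ] (+ n)    = trans (⊖-homo n (suc m)) (+-comm _ _)
  +-homo -[1+ m ] -[1+ n ] = begin
    - (suc (suc (m ℕ.+ n)) · 1#)        ≡⟨ ≡.cong (λ k → - (suc k · 1#)) (ℕ.+-suc m n) ⟨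
    - ((suc m ℕ.+ suc n) · 1#)          ≈⟨ -‿cong (×-homo-+ 1# (suc m) (suc n)) ⟩
    - (suc m · 1# + suc n · 1#)         ≈⟨ -‿+-comm _ _ ⟨
    - (suc m · 1#) + - (suc n · 1#)     ∎

  *-homo⁺ : ∀ i n → ⟦ i ℤ.* + n ⟧ℤ ≈ ⟦ i ⟧ℤ * (n · 1#)
  *-homo⁺ (+ m) n = begin
    ⟦ + m ℤ.* + n ⟧ℤ      ≡⟨ ≡.cong ⟦_⟧ℤ (≡.sym (ℤ.pos-* m n)) ⟩
    (m ℕ.* n) · 1#        ≈⟨ ×1-homo-* m n ⟩
    m · 1# * (n · 1#)     ∎
  *-homo⁺ -[1+ m ] n = begin
    ⟦ -[1+ m ] ℤ.* + n ⟧ℤ           ≡⟨ ≡.cong ⟦_⟧ℤ (ℤ.neg-distribˡ-* (+ suc m) (+ n)) ⟨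
    ⟦ ℤ.- (+ suc m ℤ.* + n) ⟧ℤ      ≈⟨ -‿homo (+ suc m ℤ.* + n) ⟩
    - ⟦ + suc m ℤ.* + n ⟧ℤ          ≈⟨ -‿cong (*-homo⁺ (+ suc m) n) ⟩
    - (suc m · 1# * (n · 1#))       ≈⟨ -‿distribˡ-* _ _ ⟩
    - (suc m · 1#) * (n · 1#)       ∎

  *-homo : ∀ i j → ⟦ i ℤ.* j ⟧ℤ ≈ ⟦ i ⟧ℤ * ⟦ j ⟧ℤ
  *-homo i (+ n)    = *-homo⁺ i n
  *-homo i -[1+ n ] = begin
    ⟦ i ℤ.* -[1+ n ] ⟧ℤ             ≡⟨ ≡.cong ⟦_⟧ℤ (ℤ.neg-distribʳ-* i (+ suc n)) ⟨
    ⟦ ℤ.- (i ℤ.* + suc n) ⟧ℤ        ≈⟨ -‿homo (i ℤ.* + suc n) ⟩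
    - ⟦ i ℤ.* + suc n ⟧ℤ            ≈⟨ -‿cong (*-homo⁺ i (suc n)) ⟩
    - (⟦ i ⟧ℤ * (suc n · 1#))       ≈⟨ -‿distribʳ-* _ _ ⟩
    ⟦ i ⟧ℤ * - (suc n · 1#)         ∎

  homomorphism : ℤ.+-*-rawRing -Raw-AlmostCommutative⟶ fromCommutativeRing R
  homomorphism = record
    { ⟦_⟧    = ⟦_⟧ℤ
    ; +-homo = +-homo
    ; *-homo = *-homo
    ; -‿homo = -‿homo
    ; 0-homo = refl
    ; 1-homo = refl
    }

  -- Collecting terms requires a test for equal coefficients. Equality in `R` offers none, so
  -- coefficients are compared as integers.
  coefficient≟ : ∀ i j → Maybe (⟦ i ⟧ℤ ≈ ⟦ j ⟧ℤ)
  coefficient≟ i j with i ℤ.≟ j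
  ... | yes i≡j = just (reflexive (≡.cong ⟦_⟧ℤ i≡j))
  ... | no  _   = nothing

  open Algebra.Solver.Ring ℤ.+-*-rawRing (fromCommutativeRing R) homomorphism coefficient≟ public
    using (solve; _:=_; _:+_; _:*_; _:-_; :-_; con)

-- Determinants as alternating multilinear functions of a list of columns

module Alternants {c ℓ} (R : CommutativeRing c ℓ) where

  open CommutativeRing R
  open RingProperties ring
  open IntegerCoefficients R
  open SetoidReasoning setoid

  -- As a function of the point, a column is not affected by the deletion of a row, so a minor is
  -- given by a sublist of the same columns.
  Column : Set c
  Column = Carrier → Carrier

  -- Laplace expansion along a row: if W gives the minors of the rows below,
  -- then expand y W gives those with the additional first row at the point y.
  expand : Carrier → (List Column → Carrier) → List Column → Carrier
  expand y W []       = 0#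
  expand y W (f ∷ fs) = f y * W fs - expand y (W ∘ (f ∷_)) fs

  -- The determinant with a row for each point y, a column for each function f
  -- and entries f y; it is 0 for non-square shapes.
  det : List Carrier → List Column → Carrier
  det []       []      = 1#
  det []       (_ ∷ _) = 0#
  det (y ∷ ys) fs      = expand y (det ys) fs

  -- Minors are taken on sublists, which inherit `All P`. This allows minors that vanish only for
  -- columns of a certain kind.
  expand-zero-on : ∀ {p} {P : Column → Set p} y W fs → (∀ {gs} → All P gs → W gs ≈ 0#) →
                All P fs → expand y W fs ≈ 0#
  expand-zero-on y W []       W≈0 []         = refl
  expand-zero-on y W (f ∷ fs) W≈0 (pf ∷ pfs) = begin
    f y * W fs - expand y (W ∘ (f ∷_)) fs   ≈⟨ +-cong (*-congˡ (W≈0 pfs))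
                                                      (-‿cong (expand-zero-on y (W ∘ (f ∷_)) fs (W≈0 ∘ (pf ∷_)) pfs)) ⟩
    f y * 0# - 0#                           ≈⟨ solve 1 (λ x → x :* con 0ℤ :- con 0ℤ := con 0ℤ) refl (f y) ⟩
    0#                                      ∎

  expand-zero : ∀ y W fs → (∀ gs → W gs ≈ 0#) → expand y W fs ≈ 0#
  expand-zero y W fs W≈0 = expand-zero-on y W fs (λ {gs} _ → W≈0 gs) (All.universal (λ _ → tt) fs)

  expand-neg : ∀ y {W W′} fs → (∀ gs → W gs ≈ - W′ gs) → expand y W fs ≈ - expand y W′ fs
  expand-neg y          []       W≈W′ = sym -0#≈0#
  expand-neg y {W} {W′} (f ∷ fs) W≈W′ = begin
    f y * W fs - expand y (W ∘ (f ∷_)) fs           ≈⟨ +-cong (*-congˡ (W≈W′ fs)) (-‿cong (expand-neg y fs (W≈W′ ∘ (f ∷_)))) ⟩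
    f y * - W′ fs - - expand y (W′ ∘ (f ∷_)) fs     ≈⟨ solve 3 (λ a b c → a :* (:- b) :- (:- c) := :- (a :* b :- c)) refl _ _ _ ⟩
    - (f y * W′ fs - expand y (W′ ∘ (f ∷_)) fs)     ∎

  expand-linear : ∀ y a {W W₁ W₂} fs → (∀ gs → W gs ≈ W₁ gs + a * W₂ gs) →
                  expand y W fs ≈ expand y W₁ fs + a * expand y W₂ fs
  expand-linear y a []       W≈ = solve 1 (λ a → con 0ℤ := con 0ℤ :+ a :* con 0ℤ) refl a
  expand-linear y a {W} {W₁} {W₂} (f ∷ fs) W≈ = begin
    f y * W fs - expand y (W ∘ (f ∷_)) fs
      ≈⟨ +-cong (*-congˡ (W≈ fs)) (-‿cong (expand-linear y a fs (W≈ ∘ (f ∷_)))) ⟩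
    f y * (W₁ fs + a * W₂ fs) - (expand y (W₁ ∘ (f ∷_)) fs + a * expand y (W₂ ∘ (f ∷_)) fs)
      ≈⟨ solve 6 (λ x p a q r s → x :* (p :+ a :* q) :- (r :+ a :* s) := x :* p :- r :+ a :* (x :* q :- s))
           refl _ _ _ _ _ _ ⟩
    f y * W₁ fs - expand y (W₁ ∘ (f ∷_)) fs + a * (f y * W₂ fs - expand y (W₂ ∘ (f ∷_)) fs) ∎

  -- `repeat` is a separate field because `swap` only gives 2 W = 0, and 2 need not be invertible in
  -- `R`. The type `A` is arbitrary so that words of column indices or residues can take the place
  -- of columns.
  record Alternating {a} {A : Set a} (W : List A → Carrier) : Set (a Level.⊔ ℓ) where
    field
      swap   : ∀ xs a b ys → W (xs ++ a ∷ b ∷ ys) ≈ - W (xs ++ b ∷ a ∷ ys)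
      repeat : ∀ xs a ys → W (xs ++ a ∷ a ∷ ys) ≈ 0#

  open Alternating

  -- The hypothesis is pointwise, so `f` need not literally be a combination of `g` and `h`; closed
  -- forms can be substituted for it.
  Multilinear : (List Column → Carrier) → Set (c Level.⊔ ℓ)
  Multilinear W = ∀ xs {f g h a} ys → (∀ x → f x ≈ g x + a * h x) →
                  W (xs ++ f ∷ ys) ≈ W (xs ++ g ∷ ys) + a * W (xs ++ h ∷ ys)

  alternating-∷ : ∀ {a} {A : Set a} {W : List A → Carrier} x → Alternating W → Alternating (W ∘ (x ∷_))
  alternating-∷ x alt = record { swap = swap alt ∘ (x ∷_) ; repeat = repeat alt ∘ (x ∷_) }

  alternating-map : ∀ {a b} {A : Set a} {B : Set b} {W : List B → Carrier} (g : A → B) →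
                    Alternating W → Alternating (W ∘ map g)
  alternating-map {W = W} g alt = record
    { swap   = λ xs a b ys → ≡.subst₂ (λ l r → W l ≈ - W r)
                 (≡.sym (List.map-++ g xs _)) (≡.sym (List.map-++ g xs _)) (swap alt (map g xs) (g a) (g b) (map g ys))
    ; repeat = λ xs a ys → ≡.subst (λ l → W l ≈ 0#)
                 (≡.sym (List.map-++ g xs _)) (repeat alt (map g xs) (g a) (map g ys))
    }

  -- For a pair in front, the two terms that use `f` or `g` in the row `y` trade places and signs by
  -- themselves. Only the terms that keep both columns need `swap` for the minors.
  expand-swap : ∀ y {W} → Alternating W → ∀ fs f g gs →
                expand y W (fs ++ f ∷ g ∷ gs) ≈ - expand y W (fs ++ g ∷ f ∷ gs)
  expand-swap y {W} alt [] f g gs = begin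
    f y * W (g ∷ gs) - (g y * W (f ∷ gs) - expand y (W ∘ (f ∷_) ∘ (g ∷_)) gs)
      ≈⟨ +-congˡ (-‿cong (+-congˡ (-‿cong (expand-neg y gs (swap alt [] f g))))) ⟩
    f y * W (g ∷ gs) - (g y * W (f ∷ gs) - - expand y (W ∘ (g ∷_) ∘ (f ∷_)) gs)
      ≈⟨ solve 3 (λ p q r → p :- (q :- (:- r)) := :- (q :- (p :- r))) refl _ _ _ ⟩
    - (g y * W (f ∷ gs) - (f y * W (g ∷ gs) - expand y (W ∘ (g ∷_) ∘ (f ∷_)) gs)) ∎
  expand-swap y {W} alt (h ∷ fs) f g gs = begin
    h y * W (fs ++ f ∷ g ∷ gs) - expand y (W ∘ (h ∷_)) (fs ++ f ∷ g ∷ gs)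
      ≈⟨ +-cong (*-congˡ (swap alt fs f g gs)) (-‿cong (expand-swap y (alternating-∷ h alt) fs f g gs)) ⟩
    h y * - W (fs ++ g ∷ f ∷ gs) - - expand y (W ∘ (h ∷_)) (fs ++ g ∷ f ∷ gs)
      ≈⟨ solve 3 (λ a b c → a :* (:- b) :- (:- c) := :- (a :* b :- c)) refl _ _ _ ⟩
    - (h y * W (fs ++ g ∷ f ∷ gs) - expand y (W ∘ (h ∷_)) (fs ++ g ∷ f ∷ gs)) ∎

  expand-repeat : ∀ y {W} → Alternating W → ∀ fs f gs → expand y W (fs ++ f ∷ f ∷ gs) ≈ 0#
  expand-repeat y {W} alt [] f gs = begin
    f y * W (f ∷ gs) - (f y * W (f ∷ gs) - expand y (W ∘ (f ∷_) ∘ (f ∷_)) gs)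
      ≈⟨ solve 2 (λ p q → p :- (p :- q) := q) refl _ _ ⟩
    expand y (W ∘ (f ∷_) ∘ (f ∷_)) gs
      ≈⟨ expand-zero y _ gs (λ hs → repeat alt [] f hs) ⟩
    0# ∎
  expand-repeat y {W} alt (h ∷ fs) f gs = begin
    h y * W (fs ++ f ∷ f ∷ gs) - expand y (W ∘ (h ∷_)) (fs ++ f ∷ f ∷ gs)
      ≈⟨ +-cong (*-congˡ (repeat alt fs f gs)) (-‿cong (expand-repeat y (alternating-∷ h alt) fs f gs)) ⟩
    h y * 0# - 0#
      ≈⟨ solve 1 (λ x → x :* con 0ℤ :- con 0ℤ := con 0ℤ) refl (h y) ⟩
    0# ∎

  expand-multilinear : ∀ y {W} → Multilinear W → Multilinear (expand y W)
  expand-multilinear y {W} lin [] {f} {g} {h} {a} ys f≈ = begin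
    f y * W ys - expand y (W ∘ (f ∷_)) ys
      ≈⟨ +-cong (*-congʳ (f≈ y)) (-‿cong (expand-linear y a ys (λ gs → lin [] gs f≈))) ⟩
    (g y + a * h y) * W ys - (expand y (W ∘ (g ∷_)) ys + a * expand y (W ∘ (h ∷_)) ys)
      ≈⟨ solve 6 (λ g a h w p q → (g :+ a :* h) :* w :- (p :+ a :* q) := g :* w :- p :+ a :* (h :* w :- q))
           refl _ _ _ _ _ _ ⟩
    g y * W ys - expand y (W ∘ (g ∷_)) ys + a * (h y * W ys - expand y (W ∘ (h ∷_)) ys) ∎
  expand-multilinear y {W} lin (k ∷ xs) {f} {g} {h} {a} ys f≈ = begin
    k y * W (xs ++ f ∷ ys) - expand y (W ∘ (k ∷_)) (xs ++ f ∷ ys)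
      ≈⟨ +-cong (*-congˡ (lin xs ys f≈)) (-‿cong (expand-multilinear y (lin ∘ (k ∷_)) xs ys f≈)) ⟩
    k y * (W (xs ++ g ∷ ys) + a * W (xs ++ h ∷ ys))
      - (expand y (W ∘ (k ∷_)) (xs ++ g ∷ ys) + a * expand y (W ∘ (k ∷_)) (xs ++ h ∷ ys))
      ≈⟨ solve 6 (λ x p a q r s → x :* (p :+ a :* q) :- (r :+ a :* s) := x :* p :- r :+ a :* (x :* q :- s))
           refl _ _ _ _ _ _ ⟩
    k y * W (xs ++ g ∷ ys) - expand y (W ∘ (k ∷_)) (xs ++ g ∷ ys)
      + a * (k y * W (xs ++ h ∷ ys) - expand y (W ∘ (k ∷_)) (xs ++ h ∷ ys)) ∎

  det-alternating : ∀ ys → Alternating (det ys)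
  det-alternating [] = record
    { swap   = λ { [] _ _ _ → sym -0#≈0# ; (_ ∷ _) _ _ _ → sym -0#≈0# }
    ; repeat = λ { [] _ _ → refl ; (_ ∷ _) _ _ → refl }
    }
  det-alternating (y ∷ ys) = record
    { swap   = expand-swap y (det-alternating ys)
    ; repeat = expand-repeat y (det-alternating ys)
    }

  det-multilinear : ∀ ys → Multilinear (det ys)
  det-multilinear [] []      {a = a} _ _ = solve 1 (λ a → con 0ℤ := con 0ℤ :+ a :* con 0ℤ) refl a
  det-multilinear [] (_ ∷ _) {a = a} _ _ = solve 1 (λ a → con 0ℤ := con 0ℤ :+ a :* con 0ℤ) refl a
  det-multilinear (y ∷ ys) = expand-multilinear y (det-multilinear ys)

  product : List Carrier → Carrier
  product = List.foldr _*_ 1#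

  expand-scale : ∀ {p} {_~_ : Column → Column → Set p} y {k l W W′} →
                 (∀ {f g} → f ~ g → f y ≈ k * g y) →
                 (∀ {fs gs} → Pointwise _~_ fs gs → W fs ≈ l * W′ gs) →
                 ∀ {fs gs} → Pointwise _~_ fs gs → expand y W fs ≈ k * l * expand y W′ gs
  expand-scale y {k} {l} _ _ [] = sym (zeroʳ _)
  expand-scale y {k} {l} {W} {W′} f≈g W≈ {f ∷ fs} {g ∷ gs} (f~g ∷ fs~gs) = begin
    f y * W fs - expand y (W ∘ (f ∷_)) fs
      ≈⟨ +-cong (*-cong (f≈g f~g) (W≈ fs~gs)) (-‿cong (expand-scale y f≈g (W≈ ∘ (f~g ∷_)) fs~gs)) ⟩
    k * g y * (l * W′ gs) - k * l * expand y (W′ ∘ (g ∷_)) gs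
      ≈⟨ solve 5 (λ k g l w e → k :* g :* (l :* w) :- k :* l :* e := k :* l :* (g :* w :- e)) refl _ _ _ _ _ ⟩
    k * l * (g y * W′ gs - expand y (W′ ∘ (g ∷_)) gs) ∎

  -- With s = 1 this is congruence, otherwise it takes a factor out of every row. The relation `_~_`
  -- is fixed for all rows, so it survives the passage to minors.
  det-scale : ∀ {p} {_~_ : Column → Column → Set p} (s : Column) {ys} →
              All (λ y → ∀ f g → f ~ g → f y ≈ s y * g y) ys →
              ∀ {fs gs} → Pointwise _~_ fs gs → det ys fs ≈ product (map s ys) * det ys gs
  det-scale s []         []      = sym (*-identityˡ _)
  det-scale s []         (_ ∷ _) = sym (zeroʳ _)
  det-scale s (f≈ ∷ fs≈) fs~gs   = expand-scale _ (f≈ _ _) (det-scale s fs≈) fs~gs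

  product-ones : ∀ (ys : List Carrier) → product (map (λ _ → 1#) ys) ≈ 1#
  product-ones []       = refl
  product-ones (_ ∷ ys) = trans (*-identityˡ _) (product-ones ys)

  -- Agreement is asked for at the rows only: exponents may be reduced modulo t at roots of unity
  -- but not at other points.
  det-cong : ∀ {ys fs gs} → Pointwise (λ f g → All (λ y → f y ≈ g y) ys) fs gs → det ys fs ≈ det ys gs
  det-cong {ys} {fs} {gs} fs≈gs = begin
    det ys fs                                 ≈⟨ det-scale (λ _ → 1#) (All.tabulate λ y∈ys f g f≈g →
                                                   trans (All.lookup f≈g y∈ys) (sym (*-identityˡ _))) fs≈gs ⟩
    product (map (λ _ → 1#) ys) * det ys gs   ≈⟨ *-congʳ (product-ones ys) ⟩
    1# * det ys gs                            ≈⟨ *-identityˡ _ ⟩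
    det ys gs                                 ∎

  det-nonsquare : ∀ ys fs → length fs ≢ length ys → det ys fs ≈ 0#
  det-nonsquare []       []       0≢0 = contradiction ≡.refl 0≢0
  det-nonsquare []       (_ ∷ _)  _   = refl
  det-nonsquare (y ∷ ys) fs       ≢   = expand-minors fs λ gs eq →
    det-nonsquare ys gs λ gs≡ys → ≢ (≡.trans (≡.sym eq) (≡.cong suc gs≡ys))
    where
    expand-minors : ∀ {W} fs → (∀ gs → suc (length gs) ≡ length fs → W gs ≈ 0#) → expand y W fs ≈ 0#
    expand-minors []       W≈0 = refl
    expand-minors (f ∷ fs) W≈0 = trans
      (+-cong (*-congˡ (W≈0 fs ≡.refl)) (-‿cong (expand-minors fs λ gs → W≈0 (f ∷ gs) ∘ ≡.cong suc)))
      (solve 1 (λ x → x :* con 0ℤ :- con 0ℤ := con 0ℤ) refl (f y))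

  sign : ℕ → Carrier
  sign zero    = 1#
  sign (suc k) = - sign k

  expand-last : ∀ y W fs f → All (λ g → g y ≈ 0#) fs →
                expand y W (fs ++ f ∷ []) ≈ sign (length fs) * (f y * W fs)
  expand-last y W [] f [] = solve 1 (λ x → x :- con 0ℤ := con 1ℤ :* x) refl _
  expand-last y W (g ∷ fs) f (gy≈0 ∷ fs≈0) = begin
    g y * W (fs ++ f ∷ []) - expand y (W ∘ (g ∷_)) (fs ++ f ∷ [])
      ≈⟨ +-cong (*-congʳ gy≈0) (-‿cong (expand-last y (W ∘ (g ∷_)) fs f fs≈0)) ⟩
    0# * W (fs ++ f ∷ []) - sign (length fs) * (f y * W (g ∷ fs))
      ≈⟨ solve 3 (λ a s b → con 0ℤ :* a :- s :* b := (:- s) :* b) refl _ _ _ ⟩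
    - sign (length fs) * (f y * W (g ∷ fs)) ∎

  det-vanishing : ∀ ys {f} fs → All (λ y → f y ≈ 0#) ys → det ys (f ∷ fs) ≈ 0#
  det-vanishing []       fs []           = refl
  det-vanishing (y ∷ ys) {f} fs (fy≈0 ∷ f≈0) = begin
    f y * det ys fs - expand y (det ys ∘ (f ∷_)) fs
      ≈⟨ +-cong (*-congʳ fy≈0) (-‿cong (expand-zero y _ fs (λ gs → det-vanishing ys gs f≈0))) ⟩
    0# * det ys fs - 0#
      ≈⟨ solve 1 (λ x → con 0ℤ :* x :- con 0ℤ := con 0ℤ) refl _ ⟩
    0# ∎

  -- Both columns are 0 below the first two rows, so a Laplace term survives only if it uses `u` and
  -- `v` in the rows `y` and `z`.
  det-block : ∀ y z ys {u v} fs → All (λ x → u x ≈ 0#) ys → All (λ x → v x ≈ 0#) ys →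
              det (y ∷ z ∷ ys) (u ∷ v ∷ fs) ≈ (u y * v z - v y * u z) * det ys fs
  det-block y z ys {u} {v} fs u≈0 v≈0 = begin
    u y * det (z ∷ ys) (v ∷ fs) - (v y * det (z ∷ ys) (u ∷ fs) - expand y (det (z ∷ ys) ∘ (u ∷_) ∘ (v ∷_)) fs)
      ≈⟨ +-cong (*-congˡ (pivot v≈0 fs)) (-‿cong (+-cong (*-congˡ (pivot u≈0 fs)) (-‿cong
           (expand-zero y _ fs (λ gs → trans (pivot u≈0 (v ∷ gs)) (trans (*-congˡ (det-vanishing ys gs v≈0)) (zeroʳ _))))))) ⟩
    u y * (v z * det ys fs) - (v y * (u z * det ys fs) - 0#)
      ≈⟨ solve 5 (λ a b c d e → a :* (b :* e) :- (c :* (d :* e) :- con 0ℤ) := (a :* b :- c :* d) :* e) refl _ _ _ _ _ ⟩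
    (u y * v z - v y * u z) * det ys fs ∎
    where
    pivot : ∀ {w} → All (λ x → w x ≈ 0#) ys → ∀ gs → det (z ∷ ys) (w ∷ gs) ≈ w z * det ys gs
    pivot {w} w≈0 gs = begin
      w z * det ys gs - expand z (det ys ∘ (w ∷_)) gs
        ≈⟨ +-congˡ (-‿cong (expand-zero z _ gs (λ hs → det-vanishing ys hs w≈0))) ⟩
      w z * det ys gs - 0#
        ≈⟨ solve 1 (λ a → a :- con 0ℤ := a) refl _ ⟩
      w z * det ys gs ∎

  repeated : ∀ {a} {A : Set a} {W : List A → Carrier} → Alternating W →
             ∀ x xs ys → W (x ∷ xs ++ x ∷ ys) ≈ 0#
  repeated alt x []       ys = repeat alt [] x ys
  repeated {W = W} alt x (w ∷ xs) ys = begin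
    W (x ∷ w ∷ xs ++ x ∷ ys)     ≈⟨ swap alt [] x w _ ⟩
    - W (w ∷ x ∷ xs ++ x ∷ ys)   ≈⟨ -‿cong (repeated (alternating-∷ w alt) x xs ys) ⟩
    - 0#                         ≈⟨ -0#≈0# ⟩
    0#                           ∎

  ∈⇒zero : ∀ {a} {A : Set a} {W : List A → Carrier} → Alternating W →
           ∀ {x xs} → x ∈ xs → W (x ∷ xs) ≈ 0#
  ∈⇒zero alt {x} x∈xs with ys , zs , ≡.refl ← ∈-∃++ x∈xs = repeated alt x ys zs

  -- The extra term of multilinearity contains `h` twice.
  subtract-column : ∀ {W} → Alternating W → Multilinear W → ∀ {f g} h a {fs} → h ∈ fs →
                    (∀ x → g x ≈ f x - a * h x) → W (f ∷ fs) ≈ W (g ∷ fs)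
  subtract-column {W} alt lin {f} {g} h a {fs} h∈fs g≈ = begin
    W (f ∷ fs)                    ≈⟨ lin [] fs (λ x → trans
                                       (solve 3 (λ p a q → p := (p :- a :* q) :+ a :* q) refl (f x) a (h x))
                                       (+-congʳ (sym (g≈ x)))) ⟩
    W (g ∷ fs) + a * W (h ∷ fs)   ≈⟨ +-congˡ (trans (*-congˡ (∈⇒zero alt h∈fs)) (zeroʳ a)) ⟩
    W (g ∷ fs) + 0#               ≈⟨ +-identityʳ _ ⟩
    W (g ∷ fs)                    ∎

  module _ {a} {A : Set a} (_≟_ : DecidableEquality A) where

    open DecMembership _≟_ using (_∈?_)

    unique-or-zero : ∀ {W : List A → Carrier} → Alternating W → ∀ xs → Unique xs ⊎ W xs ≈ 0#
    unique-or-zero alt []       = inj₁ []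
    unique-or-zero alt (x ∷ xs) with x ∈? xs
    ... | yes x∈xs = inj₂ (∈⇒zero alt x∈xs)
    ... | no  x∉xs with unique-or-zero (alternating-∷ x alt) xs
    ...   | inj₁ unique = inj₁ (All.¬Any⇒All¬ xs x∉xs ∷ unique)
    ...   | inj₂ eq     = inj₂ eq

-- The bialternant formula from the branching rule

∸-+-∸ : ∀ {a s k m} → k ≤ a → m ≤ s → (a ∸ k) ℕ.+ (s ∸ m) ≡ a ℕ.+ s ∸ (k ℕ.+ m)
∸-+-∸ {a} {s} {k} {m} k≤a m≤s = begin
  (a ∸ k) ℕ.+ (s ∸ m)     ≡⟨ ℕ.+-∸-assoc (a ∸ k) m≤s ⟨
  (a ∸ k) ℕ.+ s ∸ m       ≡⟨ ≡.cong (_∸ m) (ℕ.+-∸-comm s k≤a) ⟨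
  a ℕ.+ s ∸ k ∸ m         ≡⟨ ℕ.∸-+-assoc (a ℕ.+ s) k m ⟩
  a ℕ.+ s ∸ (k ℕ.+ m)     ∎
  where open ≡.≡-Reasoning

module Bialternant {c ℓ₁ ℓ₂} (F : HeytingField c ℓ₁ ℓ₂) where

  ring : CommutativeRing c ℓ₁
  ring = HeytingCommutativeRing.commutativeRing (HeytingField.heytingCommutativeRing F)

  open CommutativeRing ring hiding (ring)
  open OverField F using (_^_; sumOver; schur)
  open Exp semiring using (^-homo-*; ^-congʳ)
  open IntegerCoefficients ring
  open Alternants ring
  open SetoidReasoning setoid

  sum-cong : ∀ {a} {A : Set a} {f g : A → Carrier} {L} → All (λ a → f a ≈ g a) L → sumOver L f ≈ sumOver L g
  sum-cong []         = refl
  sum-cong (eq ∷ eqs) = +-cong eq (sum-cong eqs)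

  *-distribˡ-sum : ∀ {a} {A : Set a} x (L : List A) f → x * sumOver L f ≈ sumOver L (λ a → x * f a)
  *-distribˡ-sum x []      f = zeroʳ x
  *-distribˡ-sum x (a ∷ L) f = trans (distribˡ _ _ _) (+-congˡ (*-distribˡ-sum x L f))

  *-distribʳ-sum : ∀ {a} {A : Set a} x (L : List A) f → sumOver L f * x ≈ sumOver L (λ a → f a * x)
  *-distribʳ-sum x []      f = zeroˡ x
  *-distribʳ-sum x (a ∷ L) f = trans (distribʳ _ _ _) (+-congˡ (*-distribʳ-sum x L f))

  sum-++ : ∀ {a} {A : Set a} (L M : List A) f → sumOver (L ++ M) f ≈ sumOver L f + sumOver M f
  sum-++ []      M f = sym (+-identityˡ _)
  sum-++ (a ∷ L) M f = trans (+-congˡ (sum-++ L M f)) (sym (+-assoc _ _ _))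

  sum-map : ∀ {a b} {A : Set a} {B : Set b} (g : A → B) (L : List A) f → sumOver (map g L) f ≈ sumOver L (f ∘ g)
  sum-map g []      f = refl
  sum-map g (a ∷ L) f = +-congˡ (sum-map g L f)

  sum-product : ∀ {a b d} {A : Set a} {B : Set b} {D : Set d} (g : A → B → D) (L : List A) M f →
                sumOver (List.cartesianProductWith g L M) f ≈ sumOver L (λ a → sumOver M (λ b → f (g a b)))
  sum-product g []      M f = refl
  sum-product g (a ∷ L) M f =
    trans (sum-++ (map (g a) M) _ f) (+-cong (sum-map (g a) M f) (sum-product g L M f))

  multilinear-sum : ∀ {W} → Multilinear W → ∀ {A : Set} (L : List A) (k : A → Carrier) (g : A → Column) {f} fs →
                    (∀ x → f x ≈ sumOver L (λ a → k a * g a x)) →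
                    W (f ∷ fs) ≈ sumOver L (λ a → k a * W (g a ∷ fs))
  multilinear-sum {W} lin [] k g {f} fs f≈0 = begin
    -- A zero column satisfies f = f + 1 · f, so multilinearity gives W = W + W and hence W = 0.
    W (f ∷ fs)                                 ≈⟨ solve 1 (λ w → w := w :+ con 1ℤ :* w :- w) refl _ ⟩
    W (f ∷ fs) + 1# * W (f ∷ fs) - W (f ∷ fs)  ≈⟨ +-congʳ (lin [] fs (λ x → trans (f≈0 x) (sym (f+f≈0 x)))) ⟨
    W (f ∷ fs) - W (f ∷ fs)                    ≈⟨ -‿inverseʳ _ ⟩
    0#                                         ∎
    where
    f+f≈0 : ∀ x → f x + 1# * f x ≈ 0#
    f+f≈0 x = trans (+-cong (f≈0 x) (*-congˡ (f≈0 x))) (solve 0 (con 0ℤ :+ con 1ℤ :* con 0ℤ := con 0ℤ) refl)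
  multilinear-sum {W} lin (a ∷ L) k g {f} fs f≈ = begin
    W (f ∷ fs)                          ≈⟨ lin [] fs (λ x → trans (f≈ x) (+-comm _ _)) ⟩
    W (tail ∷ fs) + k a * W (g a ∷ fs)  ≈⟨ +-congʳ (multilinear-sum {W} lin L k g fs (λ _ → refl)) ⟩
    sumOver L (λ b → k b * W (g b ∷ fs)) + k a * W (g a ∷ fs)  ≈⟨ +-comm _ _ ⟩
    k a * W (g a ∷ fs) + sumOver L (λ b → k b * W (g b ∷ fs))  ∎
    where
    tail : Column
    tail x = sumOver L (λ b → k b * g b x)

  monomial : ℕ → Column
  monomial k x = x ^ k

  -- The number of parts that follow replaces N - j, which suits recursion on the vector.
  -- `betas-allFin` identifies the result with `β`.
  betas : ∀ {n} → Vec ℕ n → List ℕ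
  betas []                = []
  betas {suc n} (a ∷ lam) = a ℕ.+ n ∷ betas lam

  -- Telescoping. The enumeration `f` is a parameter because the induction moves from `f` to
  -- `f ∘ suc`, with the lost index going into `s`.
  geometric-sum : ∀ x y m s (f : ℕ → ℕ) (φ : ℕ → Carrier) → (∀ i → φ (f i) ≈ y ^ (m ∸ i) * x ^ (i ℕ.+ s)) →
                  (x - y) * sumOver (List.applyUpTo f (suc m)) φ ≈ x ^ (suc m ℕ.+ s) - y ^ suc m * x ^ s
  geometric-sum x y zero s f φ φ≈ = begin
    (x - y) * (φ (f 0) + 0#)         ≈⟨ *-congˡ (+-congʳ (φ≈ 0)) ⟩
    (x - y) * (1# * x ^ s + 0#)      ≈⟨ solve 3 (λ x y z → (x :- y) :* (con 1ℤ :* z :+ con 0ℤ)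
                                                 := x :* z :- y :* con 1ℤ :* z) refl _ _ _ ⟩
    x * x ^ s - y * 1# * x ^ s       ∎
  geometric-sum x y (suc m) s f φ φ≈ = begin
    (x - y) * (φ (f 0) + rest)
      ≈⟨ distribˡ _ _ _ ⟩
    (x - y) * φ (f 0) + (x - y) * rest
      ≈⟨ +-cong (*-congˡ (φ≈ 0))
           (geometric-sum x y m (suc s) (f ∘ suc) φ (λ i → trans (φ≈ (suc i)) (*-congˡ (^-congʳ x (≡.sym (ℕ.+-suc i s)))))) ⟩
    (x - y) * (y ^ suc m * x ^ s) + (x ^ (suc m ℕ.+ suc s) - y ^ suc m * (x * x ^ s))
      ≈⟨ +-congˡ (+-congʳ (^-congʳ x (ℕ.+-suc (suc m) s))) ⟩
    (x - y) * (y ^ suc m * x ^ s) + (x ^ (suc (suc m) ℕ.+ s) - y ^ suc m * (x * x ^ s))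
      ≈⟨ solve 5 (λ x y p q r → (x :- y) :* (p :* q) :+ (r :- p :* (x :* q)) := r :- y :* p :* q) refl _ _ _ _ _ ⟩
    x ^ (suc (suc m) ℕ.+ s) - y ^ suc (suc m) * x ^ s ∎
    where rest = sumOver (List.applyUpTo (f ∘ suc) (suc m)) φ

  -- Subtracting y^(b_j - b_{j+1}) times column j + 1 from column j, where b_j is the
  -- exponent of column j, gives a column divisible by x - y. The quotient is a sum of
  -- monomials, one for each part μ_j that interlacing allows in place j.
  quotients : ∀ {n} → Carrier → Vec ℕ (suc n) → List Column
  quotients         y (_ ∷ [])       = []
  quotients {suc n} y (a ∷ b ∷ lam)  =
    (λ x → sumOver [ b ⋯ a ] (λ k → y ^ (a ∸ k) * x ^ (k ℕ.+ n))) ∷ quotients y (b ∷ lam)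

  differences : ∀ {n} → Carrier → Vec ℕ (suc n) → List Column
  differences y lam = map (λ h x → (x - y) * h x) (quotients y lam)

  -- The columns are treated from the left, so that the right neighbour is still a monomial when it
  -- is subtracted. The last column has no neighbour and stays.
  reduce-columns : ∀ {W} → Alternating W → Multilinear W → ∀ {n} y (lam : Vec ℕ (suc n)) → IsPartition lam →
                   W (map monomial (betas lam)) ≈ W (differences y lam ++ monomial (Vec.last lam ℕ.+ 0) ∷ [])
  reduce-columns alt lin y (a ∷ []) _ = refl
  reduce-columns alt lin {suc n} y (a ∷ b ∷ lam) (a≥b ∷ p) =
    -- The two exponents differ by a - b + 1, where the 1 is the step of the staircase N - j. It
    -- makes both ends `b` and `a` occur in the quotient.
    trans (subtract-column alt lin (monomial (b ℕ.+ n)) (y ^ suc (a ∸ b)) (here ≡.refl) factor)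
          (reduce-columns (alternating-∷ _ alt) (lin ∘ (_ ∷_)) y (b ∷ lam) p)
    where
    open import Algebra.Properties.CommutativeSemigroup ℕ.+-commutativeSemigroup using (x∙yz≈y∙xz)
    exponent : suc (a ∸ b) ℕ.+ (b ℕ.+ n) ≡ a ℕ.+ suc n
    exponent = ≡.trans (≡.cong suc (≡.trans (≡.sym (ℕ.+-assoc (a ∸ b) b n)) (≡.cong (ℕ._+ n) (ℕ.m∸n+n≡m a≥b))))
                       (≡.sym (ℕ.+-suc a n))
    factor : ∀ x → (x - y) * sumOver [ b ⋯ a ] (λ k → y ^ (a ∸ k) * x ^ (k ℕ.+ n))
                 ≈ x ^ (a ℕ.+ suc n) - y ^ suc (a ∸ b) * x ^ (b ℕ.+ n)
    factor x = trans
      (geometric-sum x y (a ∸ b) (b ℕ.+ n) (b ℕ.+_) _ (λ i → *-cong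
        (^-congʳ y (≡.sym (ℕ.∸-+-assoc a b i)))
        (^-congʳ x (≡.trans (ℕ.+-assoc b i n) (x∙yz≈y∙xz b i n)))))
      (+-congʳ (^-congʳ x exponent))

  [⋯]-≥ : ∀ a b → All (b ≤_) [ b ⋯ a ]
  [⋯]-≥ a b = All.applyUpTo⁺₂ (b ℕ.+_) _ (ℕ.m≤m+n b)

  [⋯]-≤ : ∀ {a b} → b ≤ a → All (_≤ a) [ b ⋯ a ]
  [⋯]-≤ {a} {b} b≤a = All.applyUpTo⁺₁ (b ℕ.+_) _ λ { (s≤s i≤) → ℕ.≤-trans (ℕ.+-monoʳ-≤ b i≤) (ℕ.≤-reflexive (ℕ.m+[n∸m]≡n b≤a)) }

  All-product : ∀ {n} {p q r} {P : ℕ → Set p} {Q : Vec ℕ n → Set q} {R : Vec ℕ (suc n) → Set r} {L M} →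
                (∀ {k μ} → P k → Q μ → R (k ∷ μ)) → All P L → All Q M → All R (List.cartesianProductWith _∷_ L M)
  All-product R-∷ []         qs = []
  All-product R-∷ (pk ∷ pks) qs = All.++⁺ (All.map⁺ (All.map (R-∷ pk) qs)) (All-product R-∷ pks qs)

  -- The bound `a` in front of μ is the induction hypothesis needed to prepend a part: the rest of μ
  -- is bounded by `b`, hence by any k ≥ b.
  interlacing-linked : ∀ {n} a (lam : Vec ℕ n) → IsPartition (a ∷ lam) →
                       All (λ μ → IsPartition (a ∷ μ)) (interlacing (a ∷ lam))
  interlacing-linked a []        _         = [-] ∷ []
  interlacing-linked a (b ∷ lam) (a≥b ∷ p) =
    All-product (λ { (b≤k , k≤a) q → k≤a ∷ raise b≤k q })
      (All.zip ([⋯]-≥ a b , [⋯]-≤ a≥b)) (interlacing-linked b lam p)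
    where
    raise : ∀ {n k} {μ : Vec ℕ n} → b ≤ k → IsPartition (b ∷ μ) → IsPartition (k ∷ μ)
    raise b≤k [-]       = [-]
    raise b≤k (b≥m ∷ q) = ℕ.≤-trans b≥m b≤k ∷ q

  interlacing-partition : ∀ {n} (lam : Vec ℕ (suc n)) → IsPartition lam → All IsPartition (interlacing lam)
  interlacing-partition (a ∷ lam) p = All.map Linked.tail (interlacing-linked a lam p)

  -- This makes the truncated differences |λ| - |μ| exact, so that they add up in exponents.
  interlacing-sum : ∀ {n} a (lam : Vec ℕ n) → IsPartition (a ∷ lam) →
                    All (λ μ → Vec.sum μ ≤ Vec.sum (a ∷ lam)) (interlacing (a ∷ lam))
  interlacing-sum a []        _         = z≤n ∷ []
  interlacing-sum a (b ∷ lam) (a≥b ∷ p) = All-product ℕ.+-mono-≤ ([⋯]-≤ a≥b) (interlacing-sum b lam p)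

  -- Choosing the monomial μ_j in column j costs y^(λ_j - μ_j). The factor for the last part of λ,
  -- which has no μ_j below it, completes the exponent to |λ| - |μ|.
  expand-quotients : ∀ {W} → Multilinear W → ∀ {n} y (lam : Vec ℕ (suc n)) → IsPartition lam →
    y ^ Vec.last lam * W (quotients y lam)
      ≈ sumOver (interlacing lam) (λ μ → y ^ (Vec.sum lam ∸ Vec.sum μ) * W (map monomial (betas μ)))
  expand-quotients lin y (a ∷ []) _ = trans (*-congʳ (^-congʳ y (≡.sym (ℕ.+-identityʳ a)))) (sym (+-identityʳ _))
  expand-quotients {W} lin {suc n} y (a ∷ b ∷ lam) (a≥b ∷ p) = begin
    y ^ l * W (h ∷ hs)
      ≈⟨ *-congˡ (multilinear-sum {W} lin [ b ⋯ a ] (λ k → y ^ (a ∸ k)) (λ k → monomial (k ℕ.+ n)) hs (λ _ → refl)) ⟩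
    y ^ l * sumOver [ b ⋯ a ] (λ k → y ^ (a ∸ k) * W (monomial (k ℕ.+ n) ∷ hs))
      ≈⟨ *-distribˡ-sum _ [ b ⋯ a ] _ ⟩
    sumOver [ b ⋯ a ] (λ k → y ^ l * (y ^ (a ∸ k) * W (monomial (k ℕ.+ n) ∷ hs)))
      ≈⟨ sum-cong (All.map step ([⋯]-≤ a≥b)) ⟩
    sumOver [ b ⋯ a ] (λ k → sumOver I (λ μ → y ^ (a ℕ.+ s ∸ (k ℕ.+ Vec.sum μ)) * W (map monomial (betas (k ∷ μ)))))
      ≈⟨ sum-product _∷_ [ b ⋯ a ] I _ ⟨
    sumOver (List.cartesianProductWith _∷_ [ b ⋯ a ] I) (λ μ → y ^ (a ℕ.+ s ∸ Vec.sum μ) * W (map monomial (betas μ))) ∎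
    where
    l = Vec.last (b ∷ lam)
    s = Vec.sum (b ∷ lam)
    I = interlacing (b ∷ lam)
    hs = quotients y (b ∷ lam)
    h : Column
    h x = sumOver [ b ⋯ a ] (λ k → y ^ (a ∸ k) * x ^ (k ℕ.+ n))

    step : ∀ {k} → k ≤ a → y ^ l * (y ^ (a ∸ k) * W (monomial (k ℕ.+ n) ∷ hs))
         ≈ sumOver I (λ μ → y ^ (a ℕ.+ s ∸ (k ℕ.+ Vec.sum μ)) * W (map monomial (betas (k ∷ μ))))
    step {k} k≤a = begin
      y ^ l * (y ^ (a ∸ k) * W (monomial (k ℕ.+ n) ∷ hs))
        ≈⟨ solve 3 (λ a b c → a :* (b :* c) := b :* (a :* c)) refl _ _ _ ⟩
      y ^ (a ∸ k) * (y ^ l * W (monomial (k ℕ.+ n) ∷ hs))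
        ≈⟨ *-congˡ (expand-quotients {W ∘ (monomial (k ℕ.+ n) ∷_)} (lin ∘ (_ ∷_)) y (b ∷ lam) p) ⟩
      y ^ (a ∸ k) * sumOver I (λ μ → y ^ (s ∸ Vec.sum μ) * W (monomial (k ℕ.+ n) ∷ map monomial (betas μ)))
        ≈⟨ *-distribˡ-sum _ I _ ⟩
      sumOver I (λ μ → y ^ (a ∸ k) * (y ^ (s ∸ Vec.sum μ) * W (monomial (k ℕ.+ n) ∷ map monomial (betas μ))))
        ≈⟨ sum-cong (All.map (λ {μ} μ≤s → trans (sym (*-assoc _ _ _))
             (*-congʳ (trans (sym (^-homo-* y (a ∸ k) (s ∸ Vec.sum μ))) (^-congʳ y (∸-+-∸ k≤a μ≤s)))))
             (interlacing-sum b lam p)) ⟩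
      sumOver I (λ μ → y ^ (a ℕ.+ s ∸ (k ℕ.+ Vec.sum μ)) * W (map monomial (betas (k ∷ μ)))) ∎

  -- The last variable comes first because `schur` removes variables from the end: Laplace expansion
  -- along the first row then follows the same recursion.
  points : ∀ {n} → Vec Carrier n → List Carrier
  points {zero}  x = []
  points {suc n} x = Vec.last x ∷ points (Vec.init x)

  vandermonde : List Carrier → Carrier
  vandermonde []       = 1#
  vandermonde (y ∷ ys) = product (map (λ x → y - x) ys) * vandermonde ys

  length-points : ∀ {n} (x : Vec Carrier n) → length (points x) ≡ n
  length-points {zero}  x = ≡.refl
  length-points {suc n} x = ≡.cong suc (length-points (Vec.init x))

  length-quotients : ∀ {n} y (lam : Vec ℕ (suc n)) → length (quotients y lam) ≡ n
  length-quotients y (_ ∷ [])      = ≡.refl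
  length-quotients y (_ ∷ b ∷ lam) = ≡.cong suc (length-quotients y (b ∷ lam))

  product-neg : ∀ y ys → sign (length ys) * product (map (λ x → x - y) ys) ≈ product (map (λ x → y - x) ys)
  product-neg y []       = *-identityˡ _
  product-neg y (x ∷ ys) = trans
    (solve 4 (λ s x y p → (:- s) :* ((x :- y) :* p) := (y :- x) :* (s :* p)) refl _ _ _ _)
    (*-congˡ (product-neg y ys))

  -- After the column operations, the row of `y` is 0 except in its last entry, and the remaining
  -- minor has a factor x - y in each row x. These factors are the part of the Vandermonde product
  -- that involves `y`.
  bialternant : ∀ {n} (lam : Vec ℕ n) → IsPartition lam → (x : Vec Carrier n) →
                det (points x) (map monomial (betas lam)) ≈ schur lam x * vandermonde (points x)
  bialternant {zero}  []  _ x = sym (*-identityˡ 1#)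
  bialternant {suc n} lam p x = begin
    det (y ∷ ys) (map monomial (betas lam))
      ≈⟨ reduce-columns (det-alternating (y ∷ ys)) (det-multilinear (y ∷ ys)) y lam p ⟩
    expand y (det ys) (differences y lam ++ monomial (Vec.last lam ℕ.+ 0) ∷ [])
      ≈⟨ expand-last y (det ys) (differences y lam) _ (All.map⁺ (All.universal vanishes (quotients y lam))) ⟩
    sign (length (differences y lam)) * (y ^ (Vec.last lam ℕ.+ 0) * det ys (differences y lam))
      ≈⟨ *-cong (reflexive (≡.cong sign lengths)) (*-cong (^-congʳ y (ℕ.+-identityʳ (Vec.last lam)))
           (det-scale (λ x → x - y) (All.universal (λ x f g f~g → f~g x) ys) (pointwise (quotients y lam)))) ⟩
    sign (length ys) * (y ^ Vec.last lam * (product (map (λ x → x - y) ys) * det ys (quotients y lam)))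
      ≈⟨ solve 4 (λ a b c d → a :* (b :* (c :* d)) := a :* c :* (b :* d)) refl _ _ _ _ ⟩
    sign (length ys) * product (map (λ x → x - y) ys) * (y ^ Vec.last lam * det ys (quotients y lam))
      ≈⟨ *-cong (product-neg y ys) (expand-quotients {det ys} (det-multilinear ys) y lam p) ⟩
    product (map (λ x → y - x) ys)
      * sumOver (interlacing lam) (λ μ → y ^ (Vec.sum lam ∸ Vec.sum μ) * det ys (map monomial (betas μ)))
      ≈⟨ *-congˡ (sum-cong (All.map (λ {μ} q → trans (*-congˡ (bialternant μ q (Vec.init x))) (sym (*-assoc _ _ _)))
           (interlacing-partition lam p))) ⟩
    product (map (λ x → y - x) ys)
      * sumOver (interlacing lam) (λ μ → y ^ (Vec.sum lam ∸ Vec.sum μ) * schur μ (Vec.init x) * vandermonde ys)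
      ≈⟨ *-congˡ (sym (*-distribʳ-sum (vandermonde ys) (interlacing lam) _)) ⟩
    product (map (λ x → y - x) ys) * (schur lam x * vandermonde ys)
      ≈⟨ solve 3 (λ a b c → a :* (b :* c) := b :* (a :* c)) refl _ _ _ ⟩
    schur lam x * vandermonde (y ∷ ys) ∎
    where
    y  = Vec.last x
    ys = points (Vec.init x)
    vanishes : ∀ (h : Column) → (y - y) * h y ≈ 0#
    vanishes h = trans (*-congʳ (-‿inverseʳ y)) (zeroˡ _)
    lengths : length (differences y lam) ≡ length ys
    lengths = ≡.trans (List.length-map _ (quotients y lam))
                (≡.trans (length-quotients y lam) (≡.sym (length-points (Vec.init x))))
    pointwise : ∀ hs → Pointwise (λ f g → ∀ x → f x ≈ (x - y) * g x) (map (λ h x → (x - y) * h x) hs) hs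
    pointwise []       = []
    pointwise (h ∷ hs) = (λ _ → refl) ∷ pointwise hs

-- Lists without repetition and inversions of words

∈-↭-∷ : ∀ {a} {A : Set a} {x : A} {xs} → x ∈ xs → ∃[ ys ] xs ↭ x ∷ ys
∈-↭-∷ x∈xs with ys , zs , ≡.refl ← ∈-∃++ x∈xs = ys ++ zs , Perm.shift _ ys zs

-- The leftover `zs` is kept because it serves several counts: lengths are compared through it, and
-- in `surplus` it consists of the two residues beyond one of each.
unique-⊆⇒↭ : ∀ {a} {A : Set a} {xs ys : List A} → Unique xs → (∀ {x} → x ∈ xs → x ∈ ys) →
             ∃[ zs ] ys ↭ xs ++ zs
unique-⊆⇒↭ {ys = ys} []                      ⊆ = ys , Perm.refl
unique-⊆⇒↭ {xs = x ∷ xs} {ys} (x∉xs ∷ unique) ⊆ =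
  let ys′ , ys↭x∷ys′ = ∈-↭-∷ (⊆ (here ≡.refl))
      ⊆′ = λ {y} (y∈xs : y ∈ xs) → case Perm.∈-resp-↭ ys↭x∷ys′ (⊆ (there y∈xs)) of λ where
             (here y≡x)    → contradiction (≡.sym y≡x) (All.lookup x∉xs y∈xs)
             (there y∈ys′) → y∈ys′
      zs , ys′↭xs++zs = unique-⊆⇒↭ unique ⊆′
  in zs , Perm.trans ys↭x∷ys′ (Perm.prep x ys′↭xs++zs)

unique-⊆-length⇒↭ : ∀ {a} {A : Set a} {xs ys : List A} → Unique xs → (∀ {x} → x ∈ xs → x ∈ ys) →
                    length ys ≤ length xs → ys ↭ xs
unique-⊆-length⇒↭ {xs = xs} {ys} unique ⊆ ys≤xs with unique-⊆⇒↭ unique ⊆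
... | []     , ys↭ = ≡.subst (ys ↭_) (List.++-identityʳ xs) ys↭
... | z ∷ zs , ys↭ = contradiction ys≤xs (ℕ.<⇒≱ (≡.subst (length xs <_)
  (≡.sym (≡.trans (Perm.↭-length ys↭) (List.length-++ xs))) (ℕ.m<m+n (length xs) (s≤s z≤n))))

unique-length≤ : ∀ {a} {A : Set a} {xs ys : List A} → Unique xs → (∀ {x} → x ∈ xs → x ∈ ys) →
                 length xs ≤ length ys
unique-length≤ {xs = xs} unique ⊆ with zs , ys↭ ← unique-⊆⇒↭ unique ⊆ =
  ≡.subst (length xs ≤_) (≡.sym (≡.trans (Perm.↭-length ys↭) (List.length-++ xs))) (ℕ.m≤m+n _ _)

unique-same-elements⇒↭ : ∀ {a} {A : Set a} {xs ys : List A} → Unique xs → Unique ys →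
                         (∀ {x} → x ∈ xs → x ∈ ys) → (∀ {x} → x ∈ ys → x ∈ xs) → xs ↭ ys
unique-same-elements⇒↭ xs! ys! xs⊆ys ys⊆xs = unique-⊆-length⇒↭ ys! ys⊆xs (unique-length≤ xs! xs⊆ys)

sorted-allFin : ∀ m → AllPairs Fin._<_ (allFin m)
sorted-allFin m = AllPairs.tabulate⁺-< id

sorted⇒unique : ∀ {m} {xs : List (Fin m)} → AllPairs Fin._<_ xs → Unique xs
sorted⇒unique = AllPairs.map Fin.<⇒≢

below : ∀ {m} → Fin m → List (Fin m) → ℕ
below b bs = length (filter (Fin._<? b) bs)

below-↭ : ∀ {m} (b : Fin m) {xs ys} → xs ↭ ys → below b xs ≡ below b ys
below-↭ b xs↭ys = Perm.↭-length (Perm.filter-↭ (Fin._<? b) xs↭ys)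

below-accept : ∀ {m} {a b : Fin m} {xs} → a Fin.< b → below b (a ∷ xs) ≡ suc (below b xs)
below-accept {b = b} a<b = ≡.cong length (List.filter-accept (Fin._<? b) a<b)

below-reject : ∀ {m} {a b : Fin m} {xs} → ¬ a Fin.< b → below b (a ∷ xs) ≡ below b xs
below-reject {b = b} a≮b = ≡.cong length (List.filter-reject (Fin._<? b) a≮b)

below-all : ∀ {m} {b : Fin m} {xs} → All (Fin._< b) xs → below b xs ≡ length xs
below-all {b = b} xs<b = ≡.cong length (List.filter-all (Fin._<? b) xs<b)

below-none : ∀ {m} {b : Fin m} {xs} → All (b Fin.<_) xs → below b xs ≡ 0
below-none {b = b} xs>b = ≡.cong length (List.filter-none (Fin._<? b) (All.map (λ b<x x<b → ℕ.<-asym b<x x<b) xs>b))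

inv-sorted : ∀ {m} {xs : List (Fin m)} → AllPairs Fin._<_ xs → inv xs ≡ 0
inv-sorted []           = ≡.refl
inv-sorted (x<xs ∷ xs<) = ≡.cong₂ ℕ._+_ (below-none x<xs) (inv-sorted xs<)

module _ {m n} (f : Fin m → Fin n) (f-mono : ∀ {i j} → i Fin.< j → f i Fin.< f j)
         (f-cancel : ∀ {i j} → f i Fin.< f j → i Fin.< j) where

  below-map : ∀ b xs → below (f b) (map f xs) ≡ below b xs
  below-map b []       = ≡.refl
  below-map b (x ∷ xs) = case x Fin.<? b of λ where
    (yes x<b) → ≡.trans (below-accept (f-mono x<b)) (≡.trans (≡.cong suc (below-map b xs)) (≡.sym (below-accept x<b)))
    (no  x≮b) → ≡.trans (below-reject (x≮b ∘ f-cancel)) (≡.trans (below-map b xs) (≡.sym (below-reject x≮b)))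

  inv-map : ∀ xs → inv (map f xs) ≡ inv xs
  inv-map []       = ≡.refl
  inv-map (x ∷ xs) = ≡.cong₂ ℕ._+_ (below-map x xs) (inv-map xs)

below-allFin : ∀ {m} (b : Fin m) → below b (allFin m) ≡ toℕ b
below-allFin {suc m} Fin.zero    = ≡.cong length (List.filter-none (Fin._<? Fin.zero {m}) (All.universal (λ _ ()) (allFin (suc m))))
below-allFin {suc m} (Fin.suc b) = ≡.trans (below-accept {b = Fin.suc b} {xs = List.tabulate Fin.suc} (s≤s z≤n)) (≡.cong suc (≡.trans
  (≡.cong (below (Fin.suc b)) (≡.sym (List.map-tabulate id Fin.suc)))
  (≡.trans (below-map Fin.suc s≤s ℕ.s≤s⁻¹ b (allFin m)) (below-allFin b))))

-- With the same filter as in b-S, so that b-S is map residue (others A₁ B₁) by computation.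
others : ∀ {m} → Fin m → Fin m → List (Fin m)
others {m} A B = filter (λ j → ¬? (j Fin.≟ A) ×-dec ¬? (j Fin.≟ B)) (allFin m)

module _ {m} {A B : Fin m} where

  ∈-others : ∀ {j} → j ≢ A → j ≢ B → j ∈ others A B
  ∈-others j≢A j≢B = ∈.∈-filter⁺ _ (∈.∈-allFin _) (j≢A , j≢B)

  others-≢ : ∀ {j} → j ∈ others A B → j ≢ A × j ≢ B
  others-≢ = proj₂ ∘ ∈.∈-filter⁻ _ {xs = allFin m}

  sorted-others : AllPairs Fin._<_ (others A B)
  sorted-others = AllPairs.filter⁺ _ (sorted-allFin m)

  allFin-↭-others : A ≢ B → allFin m ↭ A ∷ B ∷ others A B
  allFin-↭-others A≢B = unique-same-elements⇒↭ (sorted⇒unique (sorted-allFin m))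
    ((A≢B ∷ All.tabulate (λ j∈ A≡j → proj₁ (others-≢ j∈) (≡.sym A≡j)))
      ∷ All.tabulate (λ j∈ B≡j → proj₂ (others-≢ j∈) (≡.sym B≡j))
      ∷ sorted⇒unique sorted-others)
    (λ {j} _ → locate j) (λ _ → ∈.∈-allFin _)
    where
    locate : ∀ j → j ∈ A ∷ B ∷ others A B
    locate j with j Fin.≟ A | j Fin.≟ B
    ... | yes j≡A | _       = here j≡A
    ... | no  _   | yes j≡B = there (here j≡B)
    ... | no  j≢A | no j≢B  = there (there (∈-others j≢A j≢B))

  private
    below-A : A ≢ B → below A (B ∷ others A B) ≡ toℕ A
    below-A A≢B = ≡.trans (≡.sym (below-reject (ℕ.n≮n (toℕ A))))
      (≡.trans (≡.sym (below-↭ A (allFin-↭-others A≢B))) (below-allFin A))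

    below-B : A ≢ B → below B (A ∷ others A B) ≡ toℕ B
    below-B A≢B = ≡.trans (≡.sym (below-reject (ℕ.n≮n (toℕ B))))
      (≡.trans (≡.sym (below-↭ B (Perm.trans (allFin-↭-others A≢B) (Perm.swap A B Perm.refl)))) (below-allFin B))

  -- In front of the sorted rest, each of A and B is inverted with all smaller columns, except that
  -- B already stands behind A. This missing inversion is the only difference from the case B < A.
  inv-others-< : A Fin.< B → suc (inv (A ∷ B ∷ others A B)) ≡ toℕ A ℕ.+ toℕ B
  inv-others-< A<B = ≡.trans (≡.sym (ℕ.+-suc (below A (B ∷ others A B)) _)) (≡.cong₂ ℕ._+_ (below-A A≢B)
    (≡.trans (≡.cong suc (≡.trans (≡.cong (below B (others A B) ℕ.+_) (inv-sorted sorted-others)) (ℕ.+-identityʳ _)))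
      (≡.trans (≡.sym (below-accept A<B)) (below-B A≢B))))
    where A≢B = Fin.<⇒≢ A<B

  inv-others-> : B Fin.< A → inv (A ∷ B ∷ others A B) ≡ toℕ A ℕ.+ toℕ B
  inv-others-> B<A = ≡.cong₂ ℕ._+_ (below-A A≢B)
    (≡.trans (≡.trans (≡.cong (below B (others A B) ℕ.+_) (inv-sorted sorted-others)) (ℕ.+-identityʳ _))
      (≡.trans (≡.sym (below-reject (ℕ.<-asym B<A))) (below-B A≢B)))
    where A≢B = λ A≡B → Fin.<⇒≢ B<A (≡.sym A≡B)

-- The reference word: beta sets decrease, so for λ = 0 the exponents left at the roots of unity are
-- t - 1, ..., 0 in this order.
descending : ∀ m → List (Fin m)
descending zero    = []
descending (suc m) = Fin.fromℕ m ∷ map Fin.inject₁ (descending m)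

map-toℕ-descending : ∀ m → map toℕ (descending m) ≡ List.downFrom m
map-toℕ-descending zero    = ≡.refl
map-toℕ-descending (suc m) = ≡.cong₂ _∷_ (Fin.toℕ-fromℕ m)
  (≡.trans (≡.sym (List.map-∘ (descending m)))
    (≡.trans (List.map-cong Fin.toℕ-inject₁ (descending m)) (map-toℕ-descending m)))

length-descending : ∀ m → length (descending m) ≡ m
length-descending m = ≡.trans (≡.sym (List.length-map toℕ (descending m)))
  (≡.trans (≡.cong length (map-toℕ-descending m)) (List.length-downFrom m))

inject₁-< : ∀ m (i : Fin m) → Fin.inject₁ i Fin.< Fin.fromℕ m
inject₁-< m i = ≡.subst₂ _<_ (≡.sym (Fin.toℕ-inject₁ i)) (≡.sym (Fin.toℕ-fromℕ m)) (Fin.toℕ<n i)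

unique-descending : ∀ m → Unique (descending m)
unique-descending zero    = []
unique-descending (suc m) =
  All.map⁺ (All.universal (λ i eq → Fin.<⇒≢ (inject₁-< m i) (≡.sym eq)) (descending m))
  ∷ AllPairs.map⁺ (AllPairs.map (_∘ Fin.inject₁-injective) (unique-descending m))

inv-descending : ∀ m → inv (descending m) ≡ m C 2
inv-descending zero    = ≡.refl
inv-descending (suc m) = begin
  below (Fin.fromℕ m) (map Fin.inject₁ (descending m)) ℕ.+ inv (map Fin.inject₁ (descending m))
    ≡⟨ ≡.cong₂ ℕ._+_ (below-all (All.map⁺ (All.universal (inject₁-< m) (descending m))))
         (inv-map Fin.inject₁ (≡.subst₂ _<_ (≡.sym (Fin.toℕ-inject₁ _)) (≡.sym (Fin.toℕ-inject₁ _)))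
           (≡.subst₂ _<_ (Fin.toℕ-inject₁ _) (Fin.toℕ-inject₁ _)) (descending m)) ⟩
  length (map Fin.inject₁ (descending m)) ℕ.+ inv (descending m)
    ≡⟨ ≡.cong₂ ℕ._+_ (≡.trans (List.length-map Fin.inject₁ (descending m)) (length-descending m)) (inv-descending m) ⟩
  m ℕ.+ m C 2
    ≡⟨ ≡.cong (ℕ._+ m C 2) (≡.sym (ℕ.nC1≡n m)) ⟩
  m C 1 ℕ.+ m C 2
    ≡⟨ ℕ.nCk+nC[k+1]≡[n+1]C[k+1] m 1 ⟩
  suc m C 2 ∎
  where open ≡.≡-Reasoning

-- Signs of rearrangements by counting inversions

module PermutationSigns {c ℓ} (R : CommutativeRing c ℓ) where

  open CommutativeRing R
  open IntegerCoefficients R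
  open Alternants R
  open Alternating
  open SetoidReasoning setoid

  sign-+ : ∀ m n → sign (m ℕ.+ n) ≈ sign m * sign n
  sign-+ zero    n = sym (*-identityˡ _)
  sign-+ (suc m) n = trans (-‿cong (sign-+ m n)) (solve 2 (λ a b → :- (a :* b) := (:- a) :* b) refl _ _)

  sign-square : ∀ n → sign n * sign n ≈ 1#
  sign-square zero    = *-identityˡ 1#
  sign-square (suc n) = trans (solve 1 (λ a → (:- a) :* (:- a) := a :* a) refl _) (sign-square n)

  -- An adjacent swap of distinct letters changes both the parity of inversions and the sign of `W`,
  -- so the product is symmetric. No permutation has to be named, and repeated letters do no harm.
  signed : ∀ {m} → (List (Fin m) → Carrier) → List (Fin m) → Carrier
  signed W xs = sign (inv xs) * W xs

  private
    signed-∷ : ∀ {m} (W : List (Fin m) → Carrier) x xs → signed W (x ∷ xs) ≈ sign (below x xs) * signed (W ∘ (x ∷_)) xs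
    signed-∷ W x xs = trans (*-congʳ (sign-+ (below x xs) _)) (*-assoc _ _ _)

    signed-swap-< : ∀ {m} {W : List (Fin m) → Carrier} → Alternating W → ∀ {x y} → x Fin.< y → ∀ xs →
                    signed W (x ∷ y ∷ xs) ≈ signed W (y ∷ x ∷ xs)
    signed-swap-< {W = W} alt {x} {y} x<y xs = begin
      sign (below x (y ∷ xs) ℕ.+ (below y xs ℕ.+ inv xs)) * W (x ∷ y ∷ xs)
        ≈⟨ *-cong (reflexive (≡.cong sign (≡.trans (≡.cong (ℕ._+ (below y xs ℕ.+ inv xs)) (below-reject (ℕ.<-asym x<y)))
             (x∙yz≈y∙xz (below x xs) (below y xs) (inv xs))))) (swap alt [] x y xs) ⟩
      sign (below y xs ℕ.+ (below x xs ℕ.+ inv xs)) * - W (y ∷ x ∷ xs)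
        ≈⟨ solve 2 (λ a b → a :* (:- b) := (:- a) :* b) refl _ _ ⟩
      sign (suc (below y xs) ℕ.+ (below x xs ℕ.+ inv xs)) * W (y ∷ x ∷ xs)
        ≈⟨ *-congʳ (reflexive (≡.cong (λ k → sign (k ℕ.+ (below x xs ℕ.+ inv xs))) (≡.sym (below-accept x<y)))) ⟩
      sign (below y (x ∷ xs) ℕ.+ (below x xs ℕ.+ inv xs)) * W (y ∷ x ∷ xs) ∎
      where open import Algebra.Properties.CommutativeSemigroup ℕ.+-commutativeSemigroup using (x∙yz≈y∙xz)

    signed-swap : ∀ {m} {W : List (Fin m) → Carrier} → Alternating W → ∀ x y xs →
                  signed W (x ∷ y ∷ xs) ≈ signed W (y ∷ x ∷ xs)
    signed-swap alt x y xs with Fin.<-cmp x y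
    ... | tri< x<y _ _      = signed-swap-< alt x<y xs
    ... | tri≈ _ ≡.refl _   = refl
    ... | tri> _ _ y<x      = sym (signed-swap-< alt y<x xs)

    signed-prep : ∀ {m} (W : List (Fin m) → Carrier) x {xs ys} → xs ↭ ys →
                  signed (W ∘ (x ∷_)) xs ≈ signed (W ∘ (x ∷_)) ys → signed W (x ∷ xs) ≈ signed W (x ∷ ys)
    signed-prep W x {xs} {ys} xs↭ys eq = begin
      signed W (x ∷ xs)                            ≈⟨ signed-∷ W x xs ⟩
      sign (below x xs) * signed (W ∘ (x ∷_)) xs   ≈⟨ *-cong (reflexive (≡.cong sign (below-↭ x xs↭ys))) eq ⟩
      sign (below x ys) * signed (W ∘ (x ∷_)) ys   ≈⟨ signed-∷ W x ys ⟨
      signed W (x ∷ ys)                            ∎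

  -- Under a common first letter x, the inversions of x with the rest depend only on which letters
  -- occur there, and `W` with x fixed is again alternating.
  signed-↭ : ∀ {m} {W : List (Fin m) → Carrier} → Alternating W → ∀ {xs ys} → xs ↭ ys → signed W xs ≈ signed W ys
  signed-↭         alt Perm.refl           = refl
  signed-↭ {W = W} alt (Perm.prep x xs↭ys) = signed-prep W x xs↭ys (signed-↭ (alternating-∷ x alt) xs↭ys)
  signed-↭ {W = W} alt {x ∷ y ∷ xs} {y ∷ x ∷ ys} (Perm.swap x y xs↭ys) = trans
    (signed-prep W x (Perm.prep y xs↭ys) (signed-prep (W ∘ (x ∷_)) y xs↭ys
      (signed-↭ (alternating-∷ y (alternating-∷ x alt)) xs↭ys)))
    (signed-swap alt x y ys)
  signed-↭ alt (Perm.trans p q)               = trans (signed-↭ alt p) (signed-↭ alt q)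

  signed-solve : ∀ {m} {W : List (Fin m) → Carrier} → Alternating W → ∀ {xs ys} → xs ↭ ys →
                 W xs ≈ sign (inv xs ℕ.+ inv ys) * W ys
  signed-solve {W = W} alt {xs} {ys} xs↭ys = begin
    W xs                                        ≈⟨ *-identityˡ _ ⟨
    1# * W xs                                   ≈⟨ *-congʳ (sign-square (inv xs)) ⟨
    sign (inv xs) * sign (inv xs) * W xs        ≈⟨ *-assoc _ _ _ ⟩
    sign (inv xs) * signed W xs                 ≈⟨ *-congˡ (signed-↭ alt xs↭ys) ⟩
    sign (inv xs) * (sign (inv ys) * W ys)      ≈⟨ *-assoc _ _ _ ⟨
    sign (inv xs) * sign (inv ys) * W ys        ≈⟨ *-congʳ (sign-+ (inv xs) (inv ys)) ⟨
    sign (inv xs ℕ.+ inv ys) * W ys             ∎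

-- Units, root counting and Laurent polynomials

module LaurentPolynomials {c ℓ₁ ℓ₂} (F : HeytingField c ℓ₁ ℓ₂) where

  open HeytingField F using (_#_; #⇒invertible)
  open CommutativeRing (Bialternant.ring F)
  open OverField F
  open Exp semiring using (^-homo-*)
  open IntegerCoefficients (Bialternant.ring F) using (solve; _:=_; _:+_; _:*_; _:-_; :-_; con)
  open SetoidReasoning setoid
  open import Algebra.Properties.Semiring.Mult semiring using (×-homo-+)

  -- An explicit inverse instead of apartness from 0: cancellation is all that is needed, and
  -- closure under `≈`, products and negation is immediate.
  Unit : Carrier → Set (c Level.⊔ ℓ₁)
  Unit x = ∃[ y ] x * y ≈ 1#

  #⇒unit : ∀ {x y} → x # y → Unit (x - y)
  #⇒unit x#y with y , _ , xy≈1 ← #⇒invertible x#y = y , xy≈1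

  *-recip : ∀ {x} (x#0 : x # 0#) → x * recip x#0 ≈ 1#
  *-recip {x} x#0 = trans (*-congʳ (solve 1 (λ x → x := x :- con 0ℤ) refl x)) (proj₂ (proj₂ (#⇒invertible x#0)))

  #0⇒unit : ∀ {x} → x # 0# → Unit x
  #0⇒unit x#0 = recip x#0 , *-recip x#0

  unit-* : ∀ {x y} → Unit x → Unit y → Unit (x * y)
  unit-* {x} {y} (x′ , xx′) (y′ , yy′) = x′ * y′ , (begin
    x * y * (x′ * y′)   ≈⟨ solve 4 (λ x y x′ y′ → x :* y :* (x′ :* y′) := x :* x′ :* (y :* y′)) refl _ _ _ _ ⟩
    x * x′ * (y * y′)   ≈⟨ *-cong xx′ yy′ ⟩
    1# * 1#             ≈⟨ *-identityˡ 1# ⟩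
    1#                  ∎)

  unit-resp : ∀ {x y} → x ≈ y → Unit x → Unit y
  unit-resp x≈y (x′ , xx′) = x′ , trans (*-congʳ (sym x≈y)) xx′

  unit-neg : ∀ {x} → Unit x → Unit (- x)
  unit-neg (x′ , xx′) = - x′ , trans (solve 2 (λ x y → (:- x) :* (:- y) := x :* y) refl _ _) xx′

  unit-^ : ∀ {x} k → Unit x → Unit (x ^ k)
  unit-^ zero    u = 1# , *-identityˡ 1#
  unit-^ (suc k) u = unit-* u (unit-^ k u)

  unit-cancel : ∀ {x y z} → Unit x → x * y ≈ x * z → y ≈ z
  unit-cancel {x} {y} {z} (x′ , xx′) xy≈xz = begin
    y             ≈⟨ drop y ⟩
    x′ * (x * y)  ≈⟨ *-congˡ xy≈xz ⟩
    x′ * (x * z)  ≈⟨ drop z ⟨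
    z             ∎
    where
    drop : ∀ w → w ≈ x′ * (x * w)
    drop w = sym (trans (solve 3 (λ a b c → a :* (b :* c) := b :* a :* c) refl _ _ _) (trans (*-congʳ xx′) (*-identityˡ w)))

  unit-cancel-0 : ∀ {x y} → Unit x → x * y ≈ 0# → y ≈ 0#
  unit-cancel-0 u xy≈0 = unit-cancel u (trans xy≈0 (sym (zeroʳ _)))

  -- The naturals are the supply of points with invertible differences that root counting requires
  -- in an abstract field.
  unit-natural-difference : CharacteristicZero → ∀ {m n} → m < n → Unit (n · 1# - m · 1#)
  unit-natural-difference char0 {m} {n} m<n with d , ≡.refl ← ℕ.m≤n⇒∃[o]m+o≡n m<n =
    unit-resp (begin
      suc d · 1#                          ≈⟨ solve 2 (λ a b → a := b :+ a :- b) refl _ _ ⟩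
      m · 1# + suc d · 1# - m · 1#        ≈⟨ +-congʳ (×-homo-+ 1# m (suc d)) ⟨
      (m ℕ.+ suc d) · 1# - m · 1#         ≡⟨ ≡.cong (λ k → k · 1# - m · 1#) (ℕ.+-suc m d) ⟩
      (suc m ℕ.+ d) · 1# - m · 1#         ∎)
      (#0⇒unit (char0 d))

  eval : List Carrier → Carrier → Carrier
  eval []       x = 0#
  eval (a ∷ as) x = a + x * eval as x

  _⊕_ : List Carrier → List Carrier → List Carrier
  []       ⊕ bs       = bs
  (a ∷ as) ⊕ []       = a ∷ as
  (a ∷ as) ⊕ (b ∷ bs) = a + b ∷ as ⊕ bs

  _⊗_ : List Carrier → List Carrier → List Carrier
  []       ⊗ bs = []
  (a ∷ as) ⊗ bs = map (a *_) bs ⊕ (0# ∷ as ⊗ bs)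

  eval-⊕ : ∀ as bs x → eval (as ⊕ bs) x ≈ eval as x + eval bs x
  eval-⊕ []       bs       x = sym (+-identityˡ _)
  eval-⊕ (a ∷ as) []       x = sym (+-identityʳ _)
  eval-⊕ (a ∷ as) (b ∷ bs) x = trans (+-congˡ (*-congˡ (eval-⊕ as bs x)))
    (solve 5 (λ a b x p q → a :+ b :+ x :* (p :+ q) := a :+ x :* p :+ (b :+ x :* q)) refl _ _ _ _ _)

  eval-scale : ∀ a bs x → eval (map (a *_) bs) x ≈ a * eval bs x
  eval-scale a []       x = sym (zeroʳ a)
  eval-scale a (b ∷ bs) x = trans (+-congˡ (*-congˡ (eval-scale a bs x)))
    (solve 4 (λ a b x p → a :* b :+ x :* (a :* p) := a :* (b :+ x :* p)) refl _ _ _ _)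

  eval-⊗ : ∀ as bs x → eval (as ⊗ bs) x ≈ eval as x * eval bs x
  eval-⊗ []       bs x = sym (zeroˡ _)
  eval-⊗ (a ∷ as) bs x = begin
    eval (map (a *_) bs ⊕ (0# ∷ as ⊗ bs)) x          ≈⟨ eval-⊕ (map (a *_) bs) _ x ⟩
    eval (map (a *_) bs) x + (0# + x * eval (as ⊗ bs) x)
      ≈⟨ +-cong (eval-scale a bs x) (+-congˡ (*-congˡ (eval-⊗ as bs x))) ⟩
    a * eval bs x + (0# + x * (eval as x * eval bs x))
      ≈⟨ solve 4 (λ a x p q → a :* q :+ (con 0ℤ :+ x :* (p :* q)) := (a :+ x :* p) :* q) refl _ _ _ _ ⟩
    (a + x * eval as x) * eval bs x                  ∎

  -- Synthetic division: the values at `r` of the successive tails are the Horner intermediates. The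
  -- quotient of a ∷ as by x - r is `quotient r as`, with remainder `eval (a ∷ as) r`.
  quotient : Carrier → List Carrier → List Carrier
  quotient r []       = []
  quotient r (a ∷ as) = eval (a ∷ as) r ∷ quotient r as

  length-quotient : ∀ r as → length (quotient r as) ≡ length as
  length-quotient r []       = ≡.refl
  length-quotient r (a ∷ as) = ≡.cong suc (length-quotient r as)

  eval-quotient : ∀ r a as x → eval (a ∷ as) x ≈ eval (a ∷ as) r + (x - r) * eval (quotient r as) x
  eval-quotient r a []       x = solve 3 (λ a r x → a :+ x :* con 0ℤ := a :+ r :* con 0ℤ :+ (x :- r) :* con 0ℤ) refl _ _ _
  eval-quotient r a (b ∷ as) x = trans (+-congˡ (*-congˡ (eval-quotient r b as x)))
    (solve 5 (λ a r x p q → a :+ x :* (p :+ (x :- r) :* q) := a :+ r :* p :+ (x :- r) :* (p :+ x :* q)) refl _ _ _ _ _)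

  -- Dividing by x - k uses up the root k and keeps those above it, since j - k is invertible for j
  -- > k. The explicit length `n` carries the recursion, as the quotient is not a sublist.
  vanishing-polynomial : CharacteristicZero → ∀ n as k → length as ≡ n →
                         (∀ j → k ≤ j → eval as (j · 1#) ≈ 0#) → ∀ x → eval as x ≈ 0#
  vanishing-polynomial char0 n       []       k _      _     x = refl
  vanishing-polynomial char0 (suc n) (a ∷ as) k length≡ roots x = begin
    eval (a ∷ as) x               ≈⟨ eval-quotient r a as x ⟩
    eval (a ∷ as) r + (x - r) * eval (quotient r as) x
      ≈⟨ +-cong (roots k ℕ.≤-refl) (*-congˡ (vanishing-polynomial char0 n (quotient r as) (suc k) (≡.trans (length-quotient r as) (ℕ.suc-injective length≡)) roots′ x)) ⟩
    0# + (x - r) * 0#             ≈⟨ solve 1 (λ a → con 0ℤ :+ a :* con 0ℤ := con 0ℤ) refl _ ⟩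
    0#                            ∎
    where
    r = k · 1#
    roots′ : ∀ j → suc k ≤ j → eval (quotient r as) (j · 1#) ≈ 0#
    roots′ j k<j = unit-cancel-0 (unit-natural-difference char0 k<j) (begin
      (j · 1# - r) * eval (quotient r as) (j · 1#)
        ≈⟨ solve 2 (λ a b → a := b :+ a :- b) refl _ _ ⟩
      eval (a ∷ as) r + (j · 1# - r) * eval (quotient r as) (j · 1#) - eval (a ∷ as) r
        ≈⟨ +-cong (sym (eval-quotient r a as (j · 1#))) (-‿cong (roots k ℕ.≤-refl)) ⟩
      eval (a ∷ as) (j · 1#) - 0#
        ≈⟨ +-congʳ (roots j (ℕ.<⇒≤ k<j)) ⟩
      0# - 0#
        ≈⟨ -‿inverseʳ 0# ⟩
      0# ∎)

  -- z⁻¹ is a second argument y, subject to z * y ≈ 1#.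
  record Laurent (g : Carrier → Carrier → Carrier) : Set (c Level.⊔ ℓ₁) where
    constructor laurent
    field
      shift        : ℕ
      coefficients : List Carrier
      shifted      : ∀ z y → z * y ≈ 1# → z ^ shift * g z y ≈ eval coefficients z

  private
    monomials : ℕ → List Carrier
    monomials zero    = 1# ∷ []
    monomials (suc k) = 0# ∷ monomials k

    eval-monomials : ∀ k z → eval (monomials k) z ≈ z ^ k
    eval-monomials zero    z = solve 1 (λ z → con 1ℤ :+ z :* con 0ℤ := con 1ℤ) refl z
    eval-monomials (suc k) z = trans (+-identityˡ _) (*-congˡ (eval-monomials k z))

  laurent-const : ∀ a → Laurent (λ _ _ → a)
  laurent-const a = laurent 0 (a ∷ []) λ z _ _ → solve 2 (λ a z → con 1ℤ :* a := a :+ z :* con 0ℤ) refl a z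

  laurent-z : Laurent (λ z _ → z)
  laurent-z = laurent 0 (0# ∷ 1# ∷ []) λ z _ _ →
    solve 1 (λ z → con 1ℤ :* z := con 0ℤ :+ z :* (con 1ℤ :+ z :* con 0ℤ)) refl z

  laurent-z⁻¹ : Laurent (λ _ y → y)
  laurent-z⁻¹ = laurent 1 (1# ∷ []) λ z y zy≈1 → begin
    z * 1# * y     ≈⟨ *-congʳ (*-identityʳ z) ⟩
    z * y          ≈⟨ zy≈1 ⟩
    1#             ≈⟨ solve 1 (λ z → con 1ℤ := con 1ℤ :+ z :* con 0ℤ) refl z ⟩
    1# + z * 0#    ∎

  laurent-+ : ∀ {f g} → Laurent f → Laurent g → Laurent (λ z y → f z y + g z y)
  laurent-+ {f} {g} (laurent m as f≈) (laurent n bs g≈) =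
    laurent (m ℕ.+ n) ((monomials n ⊗ as) ⊕ (monomials m ⊗ bs)) λ z y zy≈1 → begin
      z ^ (m ℕ.+ n) * (f z y + g z y)
        ≈⟨ *-congʳ (^-homo-* z m n) ⟩
      z ^ m * z ^ n * (f z y + g z y)
        ≈⟨ solve 4 (λ p q f g → p :* q :* (f :+ g) := q :* (p :* f) :+ p :* (q :* g)) refl _ _ _ _ ⟩
      z ^ n * (z ^ m * f z y) + z ^ m * (z ^ n * g z y)
        ≈⟨ +-cong (*-cong (sym (eval-monomials n z)) (f≈ z y zy≈1)) (*-cong (sym (eval-monomials m z)) (g≈ z y zy≈1)) ⟩
      eval (monomials n) z * eval as z + eval (monomials m) z * eval bs z
        ≈⟨ +-cong (eval-⊗ (monomials n) as z) (eval-⊗ (monomials m) bs z) ⟨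
      eval (monomials n ⊗ as) z + eval (monomials m ⊗ bs) z
        ≈⟨ eval-⊕ (monomials n ⊗ as) _ z ⟨
      eval ((monomials n ⊗ as) ⊕ (monomials m ⊗ bs)) z ∎

  laurent-* : ∀ {f g} → Laurent f → Laurent g → Laurent (λ z y → f z y * g z y)
  laurent-* {f} {g} (laurent m as f≈) (laurent n bs g≈) =
    laurent (m ℕ.+ n) (as ⊗ bs) λ z y zy≈1 → begin
      z ^ (m ℕ.+ n) * (f z y * g z y)          ≈⟨ *-congʳ (^-homo-* z m n) ⟩
      z ^ m * z ^ n * (f z y * g z y)          ≈⟨ solve 4 (λ p q f g → p :* q :* (f :* g) := (p :* f) :* (q :* g)) refl _ _ _ _ ⟩
      z ^ m * f z y * (z ^ n * g z y)          ≈⟨ *-cong (f≈ z y zy≈1) (g≈ z y zy≈1) ⟩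
      eval as z * eval bs z                    ≈⟨ eval-⊗ as bs z ⟨
      eval (as ⊗ bs) z                         ∎

  laurent-^ : ∀ {f} k → Laurent f → Laurent (λ z y → f z y ^ k)
  laurent-^ zero    f-L = laurent-const 1#
  laurent-^ (suc k) f-L = laurent-* f-L (laurent-^ k f-L)

  laurent-sum : ∀ {a} {A : Set a} (L : List A) {f : A → Carrier → Carrier → Carrier} → (∀ a → Laurent (f a)) →
                Laurent (λ z y → sumOver L (λ a → f a z y))
  laurent-sum []      f-L = laurent-const 0#
  laurent-sum (a ∷ L) f-L = laurent-+ (f-L a) (laurent-sum L f-L)

  -- A power of z, which is a unit, clears the denominators. The roots start at 2 because at z = 1
  -- the Vandermonde determinant is 0 and yields no information.
  vanishing-laurent : CharacteristicZero → ∀ {g} → Laurent g →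
                      (∀ j → 2 ≤ j → ∀ y → (j · 1#) * y ≈ 1# → g (j · 1#) y ≈ 0#) →
                      ∀ z y → z * y ≈ 1# → g z y ≈ 0#
  vanishing-laurent char0 (laurent m as g≈) roots z y zy≈1 =
    unit-cancel-0 (unit-^ m (y , zy≈1))
      (trans (g≈ z y zy≈1) (vanishing-polynomial char0 (length as) as 2 ≡.refl roots′ z))
    where
    roots′ : ∀ j → 2 ≤ j → eval as (j · 1#) ≈ 0#
    roots′ (suc j) 2≤j with y , jy≈1 ← #0⇒unit (char0 j) =
      trans (sym (g≈ (suc j · 1#) y jy≈1)) (trans (*-congˡ (roots (suc j) 2≤j y jy≈1)) (zeroʳ _))

  evaluate : ∀ {n} → Vec (Carrier → Carrier → Carrier) n → Carrier → Carrier → Vec Carrier n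
  evaluate X z y = Vec.map (λ g → g z y) X

  last-map : ∀ {a b} {A : Set a} {B : Set b} {n} (f : A → B) (v : Vec A (suc n)) → Vec.last (Vec.map f v) ≡ f (Vec.last v)
  last-map f (a ∷ [])     = ≡.refl
  last-map f (a ∷ b ∷ v)  = last-map f (b ∷ v)

  init-map : ∀ {a b} {A : Set a} {B : Set b} {n} (f : A → B) (v : Vec A (suc n)) → Vec.init (Vec.map f v) ≡ Vec.map f (Vec.init v)
  init-map f (a ∷ [])     = ≡.refl
  init-map f (a ∷ b ∷ v)  = ≡.cong (f a ∷_) (init-map f (b ∷ v))

  All-last : ∀ {a p} {A : Set a} {P : A → Set p} {n} {v : Vec A (suc n)} → VecAll.All P v → P (Vec.last v)
  All-last {v = _ ∷ []}    (p ∷ [])     = p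
  All-last {v = _ ∷ _ ∷ _} (_ ∷ p ∷ ps) = All-last (p ∷ ps)

  All-init : ∀ {a p} {A : Set a} {P : A → Set p} {n} {v : Vec A (suc n)} → VecAll.All P v → VecAll.All P (Vec.init v)
  All-init {v = _ ∷ []}    (p ∷ [])     = []
  All-init {v = _ ∷ _ ∷ _} (p ∷ q ∷ ps) = p ∷ All-init (q ∷ ps)

  laurent-resp : ∀ {f g} → (∀ z y → f z y ≈ g z y) → Laurent f → Laurent g
  laurent-resp f≈g (laurent m as f≈) = laurent m as λ z y zy≈1 → trans (*-congˡ (sym (f≈g z y))) (f≈ z y zy≈1)

  laurent-schur : ∀ {n} (lam : Vec ℕ n) {X : Vec (Carrier → Carrier → Carrier) n} → VecAll.All Laurent X →
                  Laurent (λ z y → schur lam (evaluate X z y))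
  laurent-schur {zero}  lam     X-L = laurent-const 1#
  laurent-schur {suc n} lam {X} X-L = laurent-resp
    (λ z y → reflexive (≡.cong₂ (λ x xs → sumOver (interlacing lam) (λ μ → x ^ (Vec.sum lam ∸ Vec.sum μ) * schur μ xs))
      (≡.sym (last-map (λ g → g z y) X)) (≡.sym (init-map (λ g → g z y) X))))
    (laurent-sum (interlacing lam) λ μ →
      laurent-* (laurent-^ (Vec.sum lam ∸ Vec.sum μ) (All-last X-L)) (laurent-schur μ (All-init X-L)))

  -- The 2 × 2 determinant of the columns x^a₁ - x^a₂ and x^b₁ - x^b₂ in the rows `y` and `z`.
  block : (y z : Carrier) (a₁ a₂ b₁ b₂ : ℕ) → Carrier
  block y z a₁ a₂ b₁ b₂ =
    (y ^ a₁ - y ^ a₂) * (z ^ b₁ - z ^ b₂) - (y ^ b₁ - y ^ b₂) * (z ^ a₁ - z ^ a₂)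

-- Alternants at the roots of unity together with z and its inverse

toList-tabulate : ∀ {a} {A : Set a} {n} (f : Fin n → A) → Vec.toList (Vec.tabulate f) ≡ List.tabulate f
toList-tabulate {n = zero}  f = ≡.refl
toList-tabulate {n = suc n} f = ≡.cong (f Fin.zero ∷_) (toList-tabulate (f ∘ Fin.suc))

AllPairs-reverse : ∀ {a r} {A : Set a} {R : Rel A r} → Symmetric R → ∀ {xs} → AllPairs R xs → AllPairs R (List.reverse xs)
AllPairs-reverse {A = A} {R} R-sym {xs} =
  SetoidPerm.AllPairs-resp-↭ (≡.setoid A) R-sym (≡.resp₂ R) (Perm.↭⇒↭ₛ (Perm.↭-sym (Perm.↭-reverse xs)))

module RootsOfUnity {c ℓ₁ ℓ₂} (F : HeytingField c ℓ₁ ℓ₂) (t : ℕ) .{{_ : NonZero t}}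
                    (ζ : HeytingField.Carrier F) (isPrimitive : OverField.IsPrimitiveRoot F t ζ) where

  open CommutativeRing (Bialternant.ring F)
  open OverField F hiding (_·_)
  open OverField.IsPrimitiveRoot isPrimitive
  open Exp semiring using (^-homo-*; ^-congʳ; ^-congˡ; ^-assocʳ)
  open IntegerCoefficients (Bialternant.ring F) using (solve; _:=_; _:+_; _:*_; _:-_; :-_; con)
  open Alternants (Bialternant.ring F)
  open PermutationSigns (Bialternant.ring F)
  open Bialternant F
  open LaurentPolynomials F
  open SetoidReasoning setoid

  power : Fin t → Carrier
  power i = ζ ^ toℕ i

  roots : List Carrier
  roots = List.reverse (List.tabulate power)

  points-reverse : ∀ {n} (x : Vec Carrier n) → points x ≡ List.reverse (Vec.toList x)
  points-reverse {zero}  []                                     = ≡.refl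
  points-reverse {suc n} x with Vec.initLast x
  ... | init , last , ≡.refl = ≡.trans (≡.cong (last ∷_) (points-reverse init))
    (≡.sym (≡.trans (≡.cong List.reverse (Vec.toList-∷ʳ last init)) (List.reverse-++ (Vec.toList init) (last ∷ []))))

  specialization : Carrier → Carrier → Vec Carrier (t ℕ.+ 2)
  specialization z y = Vec.tabulate power Vec.++ (z ∷ y ∷ [])

  points-roots : points (Vec.tabulate power) ≡ roots
  points-roots = ≡.trans (points-reverse (Vec.tabulate power)) (≡.cong List.reverse (toList-tabulate power))

  points-specialization : ∀ z y → points (specialization z y) ≡ y ∷ z ∷ roots
  points-specialization z y = ≡.trans (points-reverse (specialization z y))
    (≡.trans (≡.cong List.reverse (≡.trans (Vec.toList-++ (Vec.tabulate power) (z ∷ y ∷ [])) (≡.cong (_++ z ∷ y ∷ []) (toList-tabulate power))))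
      (List.reverse-++ (List.tabulate power) (z ∷ y ∷ [])))

  one-^ : ∀ k → 1# ^ k ≈ 1#
  one-^ zero    = refl
  one-^ (suc k) = trans (*-identityˡ _) (one-^ k)

  ^-swap : ∀ x m n → (x ^ m) ^ n ≈ (x ^ n) ^ m
  ^-swap x m n = trans (^-assocʳ x m n) (trans (^-congʳ x (ℕ.*-comm m n)) (sym (^-assocʳ x n m)))

  roots^t≈1 : All (λ x → x ^ t ≈ 1#) roots
  roots^t≈1 = Perm.All-resp-↭ (Perm.↭-sym (Perm.↭-reverse (List.tabulate power))) (All.tabulate⁺ λ i →
    trans (^-swap ζ (toℕ i) t) (trans (^-congˡ (toℕ i) ζ^t≈1) (one-^ (toℕ i))))

  ^-mod : ∀ {x} k → x ^ t ≈ 1# → x ^ k ≈ x ^ toℕ (k mod t)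
  ^-mod {x} k x^t≈1 = begin
    x ^ k                              ≡⟨ ≡.cong (x ^_) (ℕ.m≡m%n+[m/n]*n k t) ⟩
    x ^ (k % t ℕ.+ k / t ℕ.* t)        ≈⟨ ^-homo-* x (k % t) _ ⟩
    x ^ (k % t) * x ^ (k / t ℕ.* t)    ≈⟨ *-congˡ (trans (sym (^-assocʳ x (k / t) t)) (trans (^-swap x (k / t) t)
                                            (trans (^-congˡ (k / t) x^t≈1) (one-^ (k / t))))) ⟩
    x ^ (k % t) * 1#                   ≈⟨ *-identityʳ _ ⟩
    x ^ (k % t)                        ≡⟨ ≡.cong (x ^_) (Fin.toℕ-fromℕ< (ℕ.m%n<n k t)) ⟨
    x ^ toℕ (k mod t)                  ∎

  unit-ζ : Unit ζ
  unit-ζ = ζ ^ ℕ.pred t , trans (reflexive (≡.cong (ζ ^_) (ℕ.suc-pred t))) ζ^t≈1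

  unit-vandermonde : ∀ {ys} → AllPairs (λ a b → Unit (a - b)) ys → Unit (vandermonde ys)
  unit-vandermonde []       = 1# , *-identityˡ 1#
  unit-vandermonde (u ∷ us) = unit-* (unit-product u) (unit-vandermonde us)
    where
    unit-product : ∀ {y ys} → All (λ x → Unit (y - x)) ys → Unit (product (map (λ x → y - x) ys))
    unit-product []       = 1# , *-identityˡ 1#
    unit-product (u ∷ us) = unit-* u (unit-product us)

  unit-vandermonde-roots : Unit (vandermonde roots)
  unit-vandermonde-roots = unit-vandermonde (AllPairs-reverse (unit-resp flip-difference ∘ unit-neg)
    (AllPairs.tabulate⁺-< difference))
    where
    flip-difference : ∀ {a b} → - (a - b) ≈ b - a
    flip-difference = solve 2 (λ a b → :- (a :- b) := b :- a) refl _ _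
    difference : ∀ {i j : Fin t} → i Fin.< j → Unit (ζ ^ toℕ i - ζ ^ toℕ j)
    difference {i} {j} i<j with d , i+1+d≡j ← ℕ.m≤n⇒∃[o]m+o≡n i<j =
      unit-resp (begin
        - (ζ ^ toℕ i * (ζ ^ suc d - 1#))      ≈⟨ solve 2 (λ a b → :- (a :* (b :- con 1ℤ)) := a :- a :* b) refl _ _ ⟩
        ζ ^ toℕ i - ζ ^ toℕ i * ζ ^ suc d     ≈⟨ +-congˡ (-‿cong (^-homo-* ζ (toℕ i) (suc d))) ⟨
        ζ ^ toℕ i - ζ ^ (toℕ i ℕ.+ suc d)     ≡⟨ ≡.cong (λ k → ζ ^ toℕ i - ζ ^ k) i+d≡j ⟩
        ζ ^ toℕ i - ζ ^ toℕ j                 ∎)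
        (unit-neg (unit-* (unit-^ (toℕ i) unit-ζ) (#⇒unit (ζ^k#1 (suc d) (s≤s z≤n)
          (ℕ.≤-<-trans (≡.subst (suc d ≤_) i+d≡j (ℕ.m≤n+m (suc d) (toℕ i))) (Fin.toℕ<n j))))))
      where
      i+d≡j : toℕ i ℕ.+ suc d ≡ toℕ j
      i+d≡j = ≡.trans (ℕ.+-suc (toℕ i) d) i+1+d≡j

  sum-replicate : ∀ n → Vec.sum (Vec.replicate n 0) ≡ 0
  sum-replicate zero    = ≡.refl
  sum-replicate (suc n) = sum-replicate n

  interlacing-zero : ∀ n → interlacing (Vec.replicate (suc n) 0) ≡ Vec.replicate n 0 ∷ []
  interlacing-zero zero    = ≡.refl
  interlacing-zero (suc n) = ≡.cong (λ I → map (0 ∷_) I ++ []) (interlacing-zero n)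

  schur-zero : ∀ {n} (x : Vec Carrier n) → schur (Vec.replicate n 0) x ≈ 1#
  schur-zero {zero}  x = refl
  schur-zero {suc n} x rewrite interlacing-zero n | sum-replicate n = begin
    1# * schur (Vec.replicate n 0) (Vec.init x) + 0#  ≈⟨ trans (+-identityʳ _) (*-identityˡ _) ⟩
    schur (Vec.replicate n 0) (Vec.init x)            ≈⟨ schur-zero (Vec.init x) ⟩
    1#                                                ∎

  zero-partition : ∀ n → IsPartition (Vec.replicate n 0)
  zero-partition zero          = []
  zero-partition (suc zero)    = [-]
  zero-partition (suc (suc n)) = z≤n ∷ zero-partition (suc n)

  betas-zero : ∀ n → betas (Vec.replicate n 0) ≡ List.downFrom n
  betas-zero zero    = ≡.refl
  betas-zero (suc n) = ≡.cong (n ∷_) (betas-zero n)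

  -- The bialternant formula for the empty partition, whose Schur polynomial is 1.
  det-vandermonde : ∀ {n} (x : Vec Carrier n) → det (points x) (map monomial (List.downFrom n)) ≈ vandermonde (points x)
  det-vandermonde {n} x = begin
    det (points x) (map monomial (List.downFrom n))              ≡⟨ ≡.cong (det (points x) ∘ map monomial) (betas-zero n) ⟨
    det (points x) (map monomial (betas (Vec.replicate n 0)))    ≈⟨ bialternant _ (zero-partition n) x ⟩
    schur (Vec.replicate n 0) x * vandermonde (points x)         ≈⟨ *-congʳ (schur-zero x) ⟩
    1# * vandermonde (points x)                                  ≈⟨ *-identityˡ _ ⟩
    vandermonde (points x)                                       ∎

  residueDet : List (Fin t) → Carrier
  residueDet rs = det roots (map (monomial ∘ toℕ) rs)

  residueDet-alternating : Alternating residueDet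
  residueDet-alternating = alternating-map (monomial ∘ toℕ) (det-alternating roots)

  det-mod : ∀ ks → det roots (map monomial ks) ≈ residueDet (map (_mod t) ks)
  det-mod ks = det-cong (pointwise ks)
    where
    pointwise : ∀ ks → Pointwise (λ f g → All (λ x → f x ≈ g x) roots)
                                 (map monomial ks) (map (monomial ∘ toℕ) (map (_mod t) ks))
    pointwise []       = []
    pointwise (k ∷ ks) = All.map (^-mod k) roots^t≈1 ∷ pointwise ks

  -- This is the Vandermonde determinant of the roots, invertible because ζ^i - ζ^j is a unit times
  -- ζ^(j - i) - 1 with 0 < j - i < t.
  unit-residueDet : Unit (residueDet (descending t))
  unit-residueDet = unit-resp (begin
    vandermonde roots                                  ≡⟨ ≡.cong vandermonde points-roots ⟨
    vandermonde (points tabulated)                     ≈⟨ det-vandermonde tabulated ⟨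
    det (points tabulated) (map monomial (List.downFrom t))
      ≡⟨ ≡.cong₂ (λ ys ks → det ys (map monomial ks)) points-roots (≡.sym (map-toℕ-descending t)) ⟩
    det roots (map monomial (map toℕ (descending t)))  ≡⟨ ≡.cong (det roots) (List.map-∘ (descending t)) ⟨
    residueDet (descending t)                          ∎) unit-vandermonde-roots
    where tabulated = Vec.tabulate power

  -- A repeated letter gives equal columns. Without repetition, a word that avoids `i` has fewer
  -- than t letters, and `det` is 0 on non-square shapes.
  missing-residue : ∀ i rs → All (_≢ i) rs → residueDet rs ≈ 0#
  missing-residue i rs ≢i with unique-or-zero Fin._≟_ residueDet-alternating rs
  ... | inj₂ vanishes = vanishes
  ... | inj₁ unique   = det-nonsquare roots _ λ lengths → ℕ.<⇒≢
          (≡.subst (length (i ∷ rs) ≤_) (List.length-tabulate id) (unique-length≤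
            (All.map (λ r≢i i≡r → r≢i (≡.sym i≡r)) ≢i ∷ unique) (λ _ → ∈.∈-allFin _)))
          (≡.trans (≡.sym (List.length-map (monomial ∘ toℕ) rs)) (≡.trans lengths length-roots))
    where
    length-roots : length roots ≡ t
    length-roots = ≡.trans (List.length-reverse (List.tabulate power)) (List.length-tabulate power)

  -- The property of being a monomial with exponent outside the class `i` passes to all minors, and
  -- after two rows only the roots are left. It is phrased for functions because `expand` no longer
  -- sees exponents.
  det-missing-residue : ∀ y z i ks → All (λ k → k mod t ≢ i) ks → det (y ∷ z ∷ roots) (map monomial ks) ≈ 0#
  det-missing-residue y z i ks ≢i =
    expand-zero-on y _ _ (λ {fs} → expand-zero-on z _ fs vanishes) (All.map⁺ (All.map (λ {k} k≢i → k , k≢i , ≡.refl) ≢i))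
    where
    exponents : ∀ {fs} → All (λ f → ∃[ k ] (k mod t ≢ i × f ≡ monomial k)) fs →
                ∃[ ls ] (All (λ k → k mod t ≢ i) ls × fs ≡ map monomial ls)
    exponents []                       = [] , [] , ≡.refl
    exponents ((k , k≢i , ≡.refl) ∷ es) with ls , ls≢i , ≡.refl ← exponents es = k ∷ ls , k≢i ∷ ls≢i , ≡.refl
    vanishes : ∀ {fs} → All (λ f → ∃[ k ] (k mod t ≢ i × f ≡ monomial k)) fs → det roots fs ≈ 0#
    vanishes es with ls , ls≢i , ≡.refl ← exponents es =
      trans (det-mod ls) (missing-residue i _ (All.map⁺ ls≢i))

  -- Allowing a₂ = b₁ in the first membership covers the overlapping pairs of a triple class.
  det-two-pairs : ∀ y z {a₁ a₂ b₁ b₂ ks} → a₂ ∈ b₁ ∷ ks → b₂ ∈ ks → a₁ mod t ≡ a₂ mod t → b₁ mod t ≡ b₂ mod t →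
                  det (y ∷ z ∷ roots) (map monomial (a₁ ∷ b₁ ∷ ks))
                    ≈ block y z a₁ a₂ b₁ b₂ * residueDet (map (_mod t) ks)
  det-two-pairs y z {a₁} {a₂} {b₁} {b₂} {ks} a₂∈ b₂∈ a≡ b≡ = begin
    D (monomial a₁ ∷ monomial b₁ ∷ map monomial ks)
      -- For a triple, a₂ is b₁, so this has to be done while the column of b₁ is still a monomial.
      ≈⟨ subtract-column {W = D} (det-alternating (y ∷ z ∷ roots)) (det-multilinear (y ∷ z ∷ roots)) (monomial a₂) 1# (∈.∈-map⁺ monomial a₂∈) (λ _ → by-one) ⟩
    D (u ∷ monomial b₁ ∷ map monomial ks)
      ≈⟨ subtract-column {W = D ∘ (u ∷_)} (alternating-∷ u (det-alternating (y ∷ z ∷ roots))) (det-multilinear (y ∷ z ∷ roots) ∘ (u ∷_))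
           (monomial b₂) 1# (∈.∈-map⁺ monomial b₂∈) (λ _ → by-one) ⟩
    D (u ∷ v ∷ map monomial ks)
      ≈⟨ det-block y z roots (map monomial ks) (vanishes a₁ a₂ a≡) (vanishes b₁ b₂ b≡) ⟩
    block y z a₁ a₂ b₁ b₂ * det roots (map monomial ks)
      ≈⟨ *-congˡ (det-mod ks) ⟩
    block y z a₁ a₂ b₁ b₂ * residueDet (map (_mod t) ks) ∎
    where
    D = det (y ∷ z ∷ roots)
    u v : Column
    u x = x ^ a₁ - x ^ a₂
    v x = x ^ b₁ - x ^ b₂
    by-one : ∀ {p q} → p - q ≈ p - 1# * q
    by-one = +-congˡ (-‿cong (sym (*-identityˡ _)))
    vanishes : ∀ k l → k mod t ≡ l mod t → All (λ x → x ^ k - x ^ l ≈ 0#) roots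
    vanishes k l eq = All.map (λ {x} x^t≈1 → trans (+-congʳ (trans (^-mod k x^t≈1)
      (trans (^-congʳ x (≡.cong toℕ eq)) (sym (^-mod l x^t≈1))))) (-‿inverseʳ _)) roots^t≈1

  vandermonde-specialization : 2 ≤ t → ∀ z y →
    vandermonde (points (specialization z y)) ≈ block y z (suc t) 1 t 0 * residueDet (descending t)
  vandermonde-specialization 2≤t z y = begin
    vandermonde (points (specialization z y))
      ≈⟨ det-vandermonde (specialization z y) ⟨
    det (points (specialization z y)) (map monomial (List.downFrom (t ℕ.+ 2)))
      ≡⟨ ≡.cong₂ (λ ys n → det ys (map monomial (List.downFrom n))) (points-specialization z y) (ℕ.+-comm t 2) ⟩
    det (y ∷ z ∷ roots) (map monomial (suc t ∷ t ∷ List.downFrom t))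
      -- The partner 1 of t + 1 lies among t - 1, ..., 0 because 2 ≤ t.
      ≈⟨ det-two-pairs y z (there (∈.∈-downFrom⁺ 2≤t)) (∈.∈-downFrom⁺ (ℕ.<⇒≤ 2≤t))
           (mod-periodic 1) (mod-periodic 0) ⟩
    block y z (suc t) 1 t 0 * residueDet (map (_mod t) (List.downFrom t))
      ≡⟨ ≡.cong (λ rs → block y z (suc t) 1 t 0 * residueDet rs) (≡.trans
           (≡.cong (map (_mod t)) (≡.sym (map-toℕ-descending t)))
           (≡.trans (≡.sym (List.map-∘ (descending t)))
             (≡.trans (List.map-cong toℕ-mod (descending t)) (List.map-id (descending t))))) ⟩
    block y z (suc t) 1 t 0 * residueDet (descending t) ∎
    where
    toℕ-mod : ∀ i → toℕ i mod t ≡ i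
    toℕ-mod i = Fin.toℕ-injective (≡.trans (Fin.toℕ-fromℕ< (ℕ.m%n<n (toℕ i) t)) (ℕ.m<n⇒m%n≡m (Fin.toℕ<n i)))
    mod-periodic : ∀ k → (k ℕ.+ t) mod t ≡ k mod t
    mod-periodic k = Fin.toℕ-injective (≡.trans (Fin.toℕ-fromℕ< (ℕ.m%n<n (k ℕ.+ t) t))
      (≡.trans (ℕ.[m+n]%n≡m%n k t) (≡.sym (Fin.toℕ-fromℕ< (ℕ.m%n<n k t)))))

-- Signs, and the blocks in terms of hyperbolic sines

⊖-less : ∀ m k → m ℤ.⊖ suc (m ℕ.+ k) ≡ -[1+ k ]
⊖-less zero    k = ≡.refl
⊖-less (suc m) k = ≡.trans (ℤ.[1+m]⊖[1+n]≡m⊖n m (suc (m ℕ.+ k))) (⊖-less m k)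

⊖-greater : ∀ m k → suc (m ℕ.+ k) ℤ.⊖ m ≡ + suc k
⊖-greater zero    k = ≡.refl
⊖-greater (suc m) k = ≡.trans (ℤ.[1+m]⊖[1+n]≡m⊖n (suc (m ℕ.+ k)) m) (⊖-greater m k)

-1^-cases : ∀ k → -1ℤ ℤ.^ k ≡ 1ℤ ⊎ -1ℤ ℤ.^ k ≡ -1ℤ
-1^-cases zero    = inj₁ ≡.refl
-1^-cases (suc k) with -1^-cases k
... | inj₁ eq = inj₂ (≡.cong (-1ℤ ℤ.*_) eq)
... | inj₂ eq = inj₁ (≡.cong (-1ℤ ℤ.*_) eq)

sgn-cases : ∀ {i} → i ≢ 0ℤ → sgn i ≡ 1ℤ ⊎ sgn i ≡ -1ℤ
sgn-cases {+ zero}    i≢0 = contradiction ≡.refl i≢0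
sgn-cases {+ suc _}   i≢0 = inj₁ ≡.refl
sgn-cases { -[1+ _ ]} i≢0 = inj₂ ≡.refl

*-cases : ∀ {i j} → i ≡ 1ℤ ⊎ i ≡ -1ℤ → j ≡ 1ℤ ⊎ j ≡ -1ℤ → i ℤ.* j ≡ 1ℤ ⊎ i ℤ.* j ≡ -1ℤ
*-cases (inj₁ ≡.refl) (inj₁ ≡.refl) = inj₁ ≡.refl
*-cases (inj₁ ≡.refl) (inj₂ ≡.refl) = inj₂ ≡.refl
*-cases (inj₂ ≡.refl) (inj₁ ≡.refl) = inj₂ ≡.refl
*-cases (inj₂ ≡.refl) (inj₂ ≡.refl) = inj₁ ≡.refl

[1+n]C2 : ∀ n → suc n C 2 ≡ n ℕ.+ n C 2
[1+n]C2 n = ≡.trans (≡.sym (ℕ.nCk+nC[k+1]≡[n+1]C[k+1] n 1)) (≡.cong (ℕ._+ n C 2) (ℕ.nC1≡n n))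

-- Pascal's rule three times gives C(t+3,2) = 3t + 3 + C(t,2). The right side displays 4t + 2 as a
-- doubled number, which disappears from the sign.
t+[t+3]C2 : ∀ t → t ℕ.+ (suc (t ℕ.+ 2) C 2) ≡ suc ((t ℕ.+ t ℕ.+ 1) ℕ.+ (t ℕ.+ t ℕ.+ 1) ℕ.+ t C 2)
t+[t+3]C2 t rewrite ℕ.+-comm t 2 | [1+n]C2 (suc (suc t)) | [1+n]C2 (suc t) | [1+n]C2 t =
  ℕSolver.solve 2 (λ t c → t :+ (con 2 :+ t :+ (con 1 :+ t :+ (t :+ c)))
    := con 1 :+ ((t :+ t :+ con 1) :+ (t :+ t :+ con 1) :+ c)) ≡.refl t (t C 2)
  where
  module ℕSolver = Data.Nat.Solver.+-*-Solver
  open ℕSolver using (_:+_; _:=_; con)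

module Hyperbolics {c ℓ₁ ℓ₂} (F : HeytingField c ℓ₁ ℓ₂) where

  open CommutativeRing (Bialternant.ring F)
  open OverField F
  open Exp semiring using (^-homo-*; ^-congʳ; ^-congˡ)
  open CommExp commutativeSemiring using (^-distrib-*)
  open IntegerCoefficients (Bialternant.ring F)
  open Alternants (Bialternant.ring F)
  open PermutationSigns (Bialternant.ring F) using (sign-+; sign-square)
  open LaurentPolynomials F
  open SetoidReasoning setoid
  open import Algebra.Properties.Semiring.Mult.TCOptimised semiring using (×ᵤ≈×)
  open import Algebra.Properties.Semiring.Mult semiring using (×1-homo-*; ×-homo-1)

  fromℤ≈⟦⟧ : ∀ i → fromℤ i ≈ ⟦ i ⟧ℤ
  fromℤ≈⟦⟧ (+ k)    = ×ᵤ≈× k 1#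
  fromℤ≈⟦⟧ -[1+ k ] = -‿cong (×ᵤ≈× (suc k) 1#)

  ⟦-1^⟧ : ∀ k → ⟦ -1ℤ ℤ.^ k ⟧ℤ ≈ sign k
  ⟦-1^⟧ zero    = refl
  ⟦-1^⟧ (suc k) = trans (*-homo -1ℤ (-1ℤ ℤ.^ k)) (trans (*-congˡ (⟦-1^⟧ k))
    (solve 1 (λ a → (:- con 1ℤ) :* a := :- a) refl _))

  power-inverse : ∀ {z y} → z * y ≈ 1# → ∀ k → z ^ k * y ^ k ≈ 1#
  power-inverse {z} {y} zy≈1 zero    = *-identityˡ 1#
  power-inverse {z} {y} zy≈1 (suc k) = trans
    (solve 4 (λ z y p q → z :* p :* (y :* q) := z :* y :* (p :* q)) refl _ _ _ _)
    (trans (*-cong zy≈1 (power-inverse zy≈1 k)) (*-identityˡ 1#))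

  block-cong : ∀ {y y′ z z′} → y ≈ y′ → z ≈ z′ → ∀ a₁ a₂ b₁ b₂ → block y z a₁ a₂ b₁ b₂ ≈ block y′ z′ a₁ a₂ b₁ b₂
  block-cong {y} {y′} {z} {z′} y≈ z≈ a₁ a₂ b₁ b₂ =
    +-cong (*-cong (diff y≈ a₁ a₂) (diff z≈ b₁ b₂)) (-‿cong (*-cong (diff y≈ b₁ b₂) (diff z≈ a₁ a₂)))
    where
    diff : ∀ {x x′} → x ≈ x′ → ∀ k l → x ^ k - x ^ l ≈ x′ ^ k - x′ ^ l
    diff x≈ k l = +-cong (^-congˡ k x≈) (-‿cong (^-congˡ l x≈))

  -- With y inverse to z, y^k - y^l = - y^(k+l) (z^k - z^l). Both products in the block therefore
  -- contain the same two differences in z.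
  factor-block : ∀ {y z} → z * y ≈ 1# → ∀ a₁ a₂ b₁ b₂ → block y z a₁ a₂ b₁ b₂
    ≈ (y ^ (b₁ ℕ.+ b₂) - y ^ (a₁ ℕ.+ a₂)) * ((z ^ a₁ - z ^ a₂) * (z ^ b₁ - z ^ b₂))
  factor-block {y} {z} zy≈1 a₁ a₂ b₁ b₂ = begin
    (y ^ a₁ - y ^ a₂) * (z ^ b₁ - z ^ b₂) - (y ^ b₁ - y ^ b₂) * (z ^ a₁ - z ^ a₂)
      ≈⟨ +-cong (*-congʳ (reflect a₁ a₂)) (-‿cong (*-congʳ (reflect b₁ b₂))) ⟩
    - (y ^ (a₁ ℕ.+ a₂) * (z ^ a₁ - z ^ a₂)) * (z ^ b₁ - z ^ b₂) - - (y ^ (b₁ ℕ.+ b₂) * (z ^ b₁ - z ^ b₂)) * (z ^ a₁ - z ^ a₂)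
      ≈⟨ solve 4 (λ p q u v → (:- (p :* u)) :* v :- (:- (q :* v)) :* u := (q :- p) :* (u :* v)) refl _ _ _ _ ⟩
    (y ^ (b₁ ℕ.+ b₂) - y ^ (a₁ ℕ.+ a₂)) * ((z ^ a₁ - z ^ a₂) * (z ^ b₁ - z ^ b₂)) ∎
    where
    reflect : ∀ k l → y ^ k - y ^ l ≈ - (y ^ (k ℕ.+ l) * (z ^ k - z ^ l))
    reflect k l = begin
      y ^ k - y ^ l
        ≈⟨ solve 2 (λ p q → p :- q := :- (q :* con 1ℤ :- p :* con 1ℤ)) refl _ _ ⟩
      - (y ^ l * 1# - y ^ k * 1#)
        ≈⟨ -‿cong (+-cong (*-congˡ (power-inverse zy≈1 k)) (-‿cong (*-congˡ (power-inverse zy≈1 l)))) ⟨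
      - (y ^ l * (z ^ k * y ^ k) - y ^ k * (z ^ l * y ^ l))
        ≈⟨ solve 4 (λ p q r s → :- (q :* (r :* p) :- p :* (s :* q)) := :- (p :* q :* (r :- s))) refl _ _ _ _ ⟩
      - (y ^ k * y ^ l * (z ^ k - z ^ l))
        ≈⟨ -‿cong (*-congʳ (^-homo-* y k l)) ⟨
      - (y ^ (k ℕ.+ l) * (z ^ k - z ^ l)) ∎

  natural-^ : ∀ j k → (j · 1#) ^ k ≈ (j ℕ.^ k) · 1#
  natural-^ j zero    = sym (×-homo-1 1#)
  natural-^ j (suc k) = trans (*-congˡ (natural-^ j k)) (sym (×1-homo-* j (j ℕ.^ k)))

  -- The block is y^(t+2) (z² - 1) z (z^t - 1)², and at a natural j ≥ 2 each z^k - 1 with k ≥ 1 is a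
  -- difference of distinct naturals.
  unit-block : CharacteristicZero → ∀ j y → 2 ≤ j → (j · 1#) * y ≈ 1# → ∀ t → 1 ≤ t → Unit (block y (j · 1#) (suc t) 1 t 0)
  unit-block char0 j y 2≤j zy≈1 t 1≤t = unit-resp (sym (begin
    block y z (suc t) 1 t 0
      ≈⟨ factor-block zy≈1 (suc t) 1 t 0 ⟩
    (y ^ (t ℕ.+ 0) - y ^ (suc t ℕ.+ 1)) * ((z ^ suc t - z ^ 1) * (z ^ t - z ^ 0))
      ≈⟨ *-congʳ (+-cong (reflexive (≡.cong (y ^_) (ℕ.+-identityʳ t))) (-‿cong (reflexive (≡.cong (y ^_) (ℕ.+-comm (suc t) 1))))) ⟩
    (y ^ t - y * (y * y ^ t)) * ((z * z ^ t - z * 1#) * (z ^ t - 1#))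
      -- A factor (zy)² = 1 turns y^t into z² y^(t+2), so that y^(t+2) can be taken out.
      ≈⟨ *-congʳ (+-congʳ (trans (sym (*-identityˡ _)) (*-congʳ (sym (trans (*-cong zy≈1 zy≈1) (*-identityˡ 1#)))))) ⟩
    (z * y * (z * y) * y ^ t - y * (y * y ^ t)) * ((z * z ^ t - z * 1#) * (z ^ t - 1#))
      ≈⟨ solve 4 (λ y z p q → (z :* y :* (z :* y) :* p :- y :* (y :* p)) :* ((z :* q :- z :* con 1ℤ) :* (q :- con 1ℤ))
            := y :* (y :* p) :* (z :* (z :* con 1ℤ) :- con 1ℤ) :* (z :* (q :- con 1ℤ) :* (q :- con 1ℤ))) refl _ _ _ _ ⟩
    y ^ suc (suc t) * (z ^ 2 - 1#) * (z * (z ^ t - 1#) * (z ^ t - 1#)) ∎))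
    (unit-* (unit-* (unit-^ (suc (suc t)) unit-y) (unit-power 2 (s≤s z≤n)))
            (unit-* (unit-* (y , zy≈1) (unit-power t 1≤t)) (unit-power t 1≤t)))
    where
    z = j · 1#
    unit-y : Unit y
    unit-y = z , trans (*-comm y z) zy≈1
    unit-power : ∀ k → 1 ≤ k → Unit (z ^ k - 1#)
    unit-power k 1≤k = unit-resp (+-cong (sym (natural-^ j k)) (-‿cong (×-homo-1 1#)))
      (unit-natural-difference char0 (ℕ.<-≤-trans 2≤j
        (ℕ.≤-trans (ℕ.≤-reflexive (≡.sym (ℕ.*-identityʳ j))) (ℕ.^-monoʳ-≤ j {{ℕ.>-nonZero (ℕ.<⇒≤ 2≤j)}} 1≤k))))

  -- sinhDouble w v k is 2 sinh(kθ/2) for w = e^{θ/2} and v = w⁻¹.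
  sinhDouble : Carrier → Carrier → ℕ → Carrier
  sinhDouble w v k = w ^ k - v ^ k

  square-^ : ∀ x k → (x ^ 2) ^ k ≈ x ^ k * x ^ k
  square-^ x k = trans (^-congˡ k (*-congˡ (*-identityʳ x))) (^-distrib-* x x k)

  -- Taking out the power of x halfway between the exponents 2(k + d) and 2k leaves x^d - x^(-d).
  square-difference : ∀ {x x′} → x * x′ ≈ 1# → ∀ k d →
                      (x ^ 2) ^ (k ℕ.+ d) - (x ^ 2) ^ k ≈ x ^ ((k ℕ.+ d) ℕ.+ k) * sinhDouble x x′ d
  square-difference {x} {x′} xx′ k d = begin
    (x ^ 2) ^ (k ℕ.+ d) - (x ^ 2) ^ k
      ≈⟨ +-cong (trans (square-^ x (k ℕ.+ d)) (*-cong (^-homo-* x k d) (^-homo-* x k d))) (-‿cong (square-^ x k)) ⟩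
    x ^ k * x ^ d * (x ^ k * x ^ d) - x ^ k * x ^ k
      ≈⟨ solve 2 (λ p q → p :* q :* (p :* q) :- p :* p := p :* q :* (p :* q) :- p :* p :* con 1ℤ) refl _ _ ⟩
    x ^ k * x ^ d * (x ^ k * x ^ d) - x ^ k * x ^ k * 1#
      ≈⟨ +-congˡ (-‿cong (*-congˡ (power-inverse xx′ d))) ⟨
    x ^ k * x ^ d * (x ^ k * x ^ d) - x ^ k * x ^ k * (x ^ d * x′ ^ d)
      ≈⟨ solve 3 (λ p q r → p :* q :* (p :* q) :- p :* p :* (q :* r) := p :* q :* p :* (q :- r)) refl _ _ _ ⟩
    x ^ k * x ^ d * x ^ k * (x ^ d - x′ ^ d)
      ≈⟨ *-congʳ (trans (^-homo-* x (k ℕ.+ d) k) (*-congʳ (^-homo-* x k d))) ⟨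
    x ^ ((k ℕ.+ d) ℕ.+ k) * (x ^ d - x′ ^ d) ∎

  square-difference′ : ∀ {x x′} → x * x′ ≈ 1# → ∀ {k l} → l ≤ k →
                       (x ^ 2) ^ k - (x ^ 2) ^ l ≈ x ^ (k ℕ.+ l) * sinhDouble x x′ (k ∸ l)
  square-difference′ {x} {x′} xx′ {k} {l} l≤k =
    ≡.subst (λ m → (x ^ 2) ^ m - (x ^ 2) ^ l ≈ x ^ (m ℕ.+ l) * sinhDouble x x′ (k ∸ l)) (ℕ.m+[n∸m]≡n l≤k)
      (square-difference xx′ l (k ∸ l))

  -- The exponents A and B are not ordered in advance; `sgn` records the order and is the source of
  -- the factor sgn(d̃₃) in the theorem.
  signed-difference : ∀ {w v} → w * v ≈ 1# → ∀ A B →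
    (v ^ 2) ^ B - (v ^ 2) ^ A
      ≈ ⟦ sgn (+ A ℤ.- + B) ⟧ℤ * (v ^ (A ℕ.+ B) * sinhDouble w v ℤ.∣ + A ℤ.- + B ∣)
  signed-difference {w} {v} wv≈1 A B rewrite ℤ.m-n≡m⊖n A B with ℕ.compare A B
  ... | ℕ.less .A k rewrite ⊖-less A k = begin
    (v ^ 2) ^ suc (A ℕ.+ k) - (v ^ 2) ^ A
      ≡⟨ ≡.cong (λ m → (v ^ 2) ^ m - (v ^ 2) ^ A) (ℕ.+-suc A k) ⟨
    (v ^ 2) ^ (A ℕ.+ suc k) - (v ^ 2) ^ A
      ≈⟨ square-difference (trans (*-comm v w) wv≈1) A (suc k) ⟩
    v ^ (A ℕ.+ suc k ℕ.+ A) * sinhDouble v w (suc k)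
      ≡⟨ ≡.cong (λ m → v ^ m * sinhDouble v w (suc k)) (≡.trans (≡.cong (ℕ._+ A) (ℕ.+-suc A k)) (ℕ.+-comm (suc (A ℕ.+ k)) A)) ⟩
    v ^ (A ℕ.+ suc (A ℕ.+ k)) * sinhDouble v w (suc k)
      ≈⟨ solve 3 (λ p q r → p :* (q :- r) := (:- con 1ℤ) :* (p :* (r :- q))) refl _ _ _ ⟩
    - 1# * (v ^ (A ℕ.+ suc (A ℕ.+ k)) * sinhDouble w v (suc k)) ∎
  ... | ℕ.equal .A rewrite ℤ.n⊖n≡0 A = trans (-‿inverseʳ _) (sym (zeroˡ _))
  ... | ℕ.greater .B k rewrite ⊖-greater B k = begin
    (v ^ 2) ^ B - (v ^ 2) ^ suc (B ℕ.+ k)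
      ≡⟨ ≡.cong (λ m → (v ^ 2) ^ B - (v ^ 2) ^ m) (ℕ.+-suc B k) ⟨
    (v ^ 2) ^ B - (v ^ 2) ^ (B ℕ.+ suc k)
      ≈⟨ solve 2 (λ p q → p :- q := :- (q :- p)) refl _ _ ⟩
    - ((v ^ 2) ^ (B ℕ.+ suc k) - (v ^ 2) ^ B)
      ≈⟨ -‿cong (square-difference (trans (*-comm v w) wv≈1) B (suc k)) ⟩
    - (v ^ (B ℕ.+ suc k ℕ.+ B) * sinhDouble v w (suc k))
      ≡⟨ ≡.cong (λ m → - (v ^ (m ℕ.+ B) * sinhDouble v w (suc k))) (ℕ.+-suc B k) ⟩
    - (v ^ (suc (B ℕ.+ k) ℕ.+ B) * sinhDouble v w (suc k))
      ≈⟨ solve 3 (λ p q r → :- (p :* (q :- r)) := con 1ℤ :* (p :* (r :- q))) refl _ _ _ ⟩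
    1# * (v ^ (suc (B ℕ.+ k) ℕ.+ B) * sinhDouble w v (suc k)) ∎

  -- The middle powers cancel: w^A and w^B from the two differences in z meet v^(A+B) from the third
  -- factor.
  hyperbolic-block : ∀ {w v} → w * v ≈ 1# → ∀ {a₁ a₂ b₁ b₂} → a₂ ≤ a₁ → b₂ ≤ b₁ →
    let d̃₃ = + (a₁ ℕ.+ a₂) ℤ.- + (b₁ ℕ.+ b₂) in
    block (v ^ 2) (w ^ 2) a₁ a₂ b₁ b₂
      ≈ ⟦ sgn d̃₃ ⟧ℤ * (sinhDouble w v (a₁ ∸ a₂) * sinhDouble w v (b₁ ∸ b₂) * sinhDouble w v ℤ.∣ d̃₃ ∣)
  hyperbolic-block {w} {v} wv≈1 {a₁} {a₂} {b₁} {b₂} a₂≤a₁ b₂≤b₁ = begin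
    block (v ^ 2) (w ^ 2) a₁ a₂ b₁ b₂
      ≈⟨ factor-block (trans (sym (^-distrib-* w v 2)) (trans (^-congˡ 2 wv≈1) (trans (*-identityˡ _) (*-identityˡ _)))) a₁ a₂ b₁ b₂ ⟩
    ((v ^ 2) ^ B - (v ^ 2) ^ A) * (((w ^ 2) ^ a₁ - (w ^ 2) ^ a₂) * ((w ^ 2) ^ b₁ - (w ^ 2) ^ b₂))
      ≈⟨ *-cong (signed-difference wv≈1 A B) (*-cong (square-difference′ wv≈1 a₂≤a₁) (square-difference′ wv≈1 b₂≤b₁)) ⟩
    s * (v ^ (A ℕ.+ B) * S₃) * (w ^ A * S₁ * (w ^ B * S₂))
      ≈⟨ *-congʳ (*-congˡ (*-congʳ (^-homo-* v A B))) ⟩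
    s * (v ^ A * v ^ B * S₃) * (w ^ A * S₁ * (w ^ B * S₂))
      ≈⟨ solve 8 (λ s p q x y r₁ r₂ r₃ → s :* (p :* q :* r₃) :* (x :* r₁ :* (y :* r₂))
           := x :* p :* (y :* q) :* (s :* (r₁ :* r₂ :* r₃))) refl _ _ _ _ _ _ _ _ ⟩
    w ^ A * v ^ A * (w ^ B * v ^ B) * (s * (S₁ * S₂ * S₃))
      ≈⟨ *-congʳ (trans (*-cong (power-inverse wv≈1 A) (power-inverse wv≈1 B)) (*-identityˡ 1#)) ⟩
    1# * (s * (S₁ * S₂ * S₃))
      ≈⟨ *-identityˡ _ ⟩
    s * (S₁ * S₂ * S₃) ∎
    where
    A = a₁ ℕ.+ a₂
    B = b₁ ℕ.+ b₂
    s = ⟦ sgn (+ A ℤ.- + B) ⟧ℤ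
    S₁ = sinhDouble w v (a₁ ∸ a₂)
    S₂ = sinhDouble w v (b₁ ∸ b₂)
    S₃ = sinhDouble w v ℤ.∣ + A ℤ.- + B ∣

-- Occupation numbers of the residue classes

count : ∀ {m} → Fin m → List (Fin m) → ℕ
count i xs = length (filter (Fin._≟ i) xs)

module _ {m} {i : Fin m} where

  count-++ : ∀ xs ys → count i (xs ++ ys) ≡ count i xs ℕ.+ count i ys
  count-++ xs ys = ≡.trans (≡.cong length (List.filter-++ (Fin._≟ i) xs ys)) (List.length-++ (filter (Fin._≟ i) xs))

  count-∷-≡ : ∀ {x} xs → x ≡ i → count i (x ∷ xs) ≡ suc (count i xs)
  count-∷-≡ xs x≡i = ≡.cong length (List.filter-accept (Fin._≟ i) {xs = xs} x≡i)

  count-∷-≢ : ∀ {x} xs → x ≢ i → count i (x ∷ xs) ≡ count i xs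
  count-∷-≢ xs x≢i = ≡.cong length (List.filter-reject (Fin._≟ i) {xs = xs} x≢i)

  count-∉ : ∀ {xs} → All (_≢ i) xs → count i xs ≡ 0
  count-∉ xs≢i = ≡.cong length (List.filter-none (Fin._≟ i) xs≢i)

  count-unique : ∀ {xs} → Unique xs → i ∈ xs → count i xs ≡ 1
  count-unique {x ∷ xs} (x∉xs ∷ _) (here i≡x) =
    ≡.trans (count-∷-≡ xs (≡.sym i≡x)) (≡.cong suc (count-∉ (All.map (λ x≢y y≡i → x≢y (≡.trans (≡.sym i≡x) (≡.sym y≡i))) x∉xs)))
  count-unique {x ∷ xs} (x∉xs ∷ unique) (there i∈xs) =
    ≡.trans (count-∷-≢ xs (All.lookup x∉xs i∈xs)) (count-unique unique i∈xs)

  length-filter-map : ∀ {a} {A : Set a} (f : A → Fin m) xs → length (filter (λ a → f a Fin.≟ i) xs) ≡ count i (map f xs)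
  length-filter-map f []       = ≡.refl
  length-filter-map f (x ∷ xs) with f x Fin.≟ i
  ... | yes _ = ≡.cong suc (length-filter-map f xs)
  ... | no  _ = length-filter-map f xs

module BetaSetProperties (t : ℕ) .{{_ : NonZero t}} (lam : Vec ℕ (t ℕ.+ 2)) (partition : IsPartition lam) where

  open BetaSet t lam

  β-antitone : ∀ {i j} → i Fin.< j → β i > β j
  β-antitone {i} {j} i<j = ℕ.+-mono-≤-< (Linked.lookup⁺ (λ a≥b b≥c → ℕ.≤-trans b≥c a≥b) partition i<j)
    (ℕ.∸-monoʳ-< (s≤s i<j) (Fin.toℕ<n j))

  β-reflects : ∀ {i j} → β i > β j → i ≢ j
  β-reflects βi>βj ≡.refl = ℕ.n≮n _ βi>βj

  occupied : ∀ {i} → n i ≢ 0 → ∃[ j ] residue j ≡ i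
  occupied {i} n≢0 with filter (λ j → residue j Fin.≟ i) (allFin N) in eq
  ... | []     = contradiction ≡.refl n≢0
  ... | j ∷ js = j , proj₂ (∈.∈-filter⁻ (λ j → residue j Fin.≟ i) {xs = allFin N} (≡.subst (j ∈_) (≡.sym eq) (here ≡.refl)))

  n≡count : ∀ i → n i ≡ count i (map residue (allFin N))
  n≡count i = length-filter-map residue (allFin N)

  -- Filtering keeps the order of the columns, so the columns of a class appear with decreasing β
  -- and the required pairs can be read off.
  residue-class : ∀ i → AllPairs (λ j k → β j > β k) (filter (λ j → residue j Fin.≟ i) (allFin N))
                      × All (λ j → residue j ≡ i) (filter (λ j → residue j Fin.≟ i) (allFin N))
  residue-class i = AllPairs.map β-antitone (AllPairs.filter⁺ (λ j → residue j Fin.≟ i) (sorted-allFin N))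
                  , All.all-filter (λ j → residue j Fin.≟ i) (allFin N)

  two-columns : ∀ {i} → n i ≡ 2 → ∃[ j ] ∃[ k ] (residue j ≡ i × residue k ≡ i × β j > β k)
  two-columns {i} n≡2 with filter (λ j → residue j Fin.≟ i) (allFin N) | residue-class i
  ... | j ∷ k ∷ [] | ((j>k ∷ []) ∷ _) , (rj ∷ rk ∷ []) = j , k , rj , rk , j>k

  three-columns : ∀ {i} → n i ≡ 3 → ∃[ j ] ∃[ k ] ∃[ l ]
                  (residue j ≡ i × residue k ≡ i × residue l ≡ i × β j > β k × β k > β l)
  three-columns {i} n≡3 with filter (λ j → residue j Fin.≟ i) (allFin N) | residue-class i
  ... | j ∷ k ∷ l ∷ [] | ((j>k ∷ _) ∷ (k>l ∷ []) ∷ _) , (rj ∷ rk ∷ rl ∷ []) = j , k , l , rj , rk , rl , j>k , k>l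

  -- The t + 2 residues contain each of the t classes once, and two are left over. Whether these two
  -- are equal decides between the profiles.
  surplus : (∀ i → n i ≢ 0) → ∃[ x ] ∃[ y ] (∀ i → n i ≡ suc (count i (x ∷ y ∷ [])))
  surplus n≢0 with unique-⊆⇒↭ {ys = map residue (allFin N)} (sorted⇒unique (sorted-allFin t))
                     (λ {i} _ → let j , rj = occupied (n≢0 i) in ≡.subst (_∈ map residue (allFin N)) rj (∈.∈-map⁺ residue (∈.∈-allFin j)))
  ... | zs , ↭zs = two zs lengths ↭zs
    where
    lengths : length zs ≡ 2
    lengths = ℕ.+-cancelˡ-≡ t _ _ (≡.trans (≡.cong (ℕ._+ length zs) (≡.sym (List.length-tabulate {n = t} id)))
      (≡.trans (≡.sym (List.length-++ (allFin t))) (≡.trans (≡.sym (Perm.↭-length ↭zs))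
        (≡.trans (List.length-map residue (allFin N)) (List.length-tabulate {n = N} id)))))
    two : ∀ zs → length zs ≡ 2 → map residue (allFin N) ↭ allFin t ++ zs →
          ∃[ x ] ∃[ y ] (∀ i → n i ≡ suc (count i (x ∷ y ∷ [])))
    two (x ∷ y ∷ []) _ ↭zs = x , y , λ i → ≡.trans (n≡count i)
      (≡.trans (Perm.↭-length (Perm.filter-↭ (Fin._≟ i) ↭zs))
        (≡.trans (count-++ {i = i} (allFin t) (x ∷ y ∷ []))
          (≡.cong (ℕ._+ count i (x ∷ y ∷ [])) (count-unique (sorted⇒unique (sorted-allFin t)) (∈.∈-allFin i)))))

  private
    count₂ : ∀ {i x y : Fin t} → x ≢ i → y ≢ i → count i (x ∷ y ∷ []) ≡ 0
    count₂ {y = y} x≢i y≢i = count-∉ (x≢i ∷ y≢i ∷ [])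

    doubles : ∀ {x y} → x Fin.< y → (∀ i → n i ≡ suc (count i (x ∷ y ∷ []))) →
              ∃[ A₁ ] ∃[ A₂ ] ∃[ B₁ ] ∃[ B₂ ] Pairs A₁ A₂ B₁ B₂
    doubles {x} {y} x<y n≡ =
      let nx = ≡.trans (n≡ x) (≡.cong suc (≡.trans (count-∷-≡ (y ∷ []) ≡.refl) (≡.cong suc (count-∉ ((x≢y ∘ ≡.sym) ∷ [])))))
          ny = ≡.trans (n≡ y) (≡.cong suc (≡.trans (count-∷-≢ (y ∷ []) x≢y) (count-∷-≡ {i = y} [] ≡.refl)))
          A₁ , A₂ , rA₁ , rA₂ , A₁>A₂ = two-columns nx
          B₁ , B₂ , rB₁ , rB₂ , B₁>B₂ = two-columns ny
      in A₁ , A₂ , B₁ , B₂ , twoDoubles x y x<y nx ny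
           (λ i i≢x i≢y → ≡.trans (n≡ i) (≡.cong suc (count₂ (i≢x ∘ ≡.sym) (i≢y ∘ ≡.sym))))
           rA₁ rA₂ A₁>A₂ rB₁ rB₂ B₁>B₂
      where
      x≢y : x ≢ y
      x≢y = Fin.<⇒≢ x<y

    triple : ∀ {x} → (∀ i → n i ≡ suc (count i (x ∷ x ∷ []))) → ∃[ A₁ ] ∃[ A₂ ] ∃[ B₁ ] ∃[ B₂ ] Pairs A₁ A₂ B₁ B₂
    triple {x} n≡ =
      let nx = ≡.trans (n≡ x) (≡.cong suc (≡.trans (count-∷-≡ {i = x} (x ∷ []) ≡.refl) (≡.cong suc (count-∷-≡ {i = x} [] ≡.refl))))
          P , Q , R , rP , rQ , rR , P>Q , Q>R = three-columns nx
      in P , Q , Q , R , oneTriple x nx (λ i i≢x → ≡.trans (n≡ i) (≡.cong suc (count₂ (i≢x ∘ ≡.sym) (i≢x ∘ ≡.sym))))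
           rP rQ rR P>Q Q>R

  pairs : (∀ i → n i ≢ 0) → ∃[ A₁ ] ∃[ A₂ ] ∃[ B₁ ] ∃[ B₂ ] Pairs A₁ A₂ B₁ B₂
  pairs n≢0 with surplus n≢0
  ... | x , y , n≡ with Fin.<-cmp x y
  ...   | tri< x<y _ _    = doubles x<y n≡
  ...   | tri≈ _ ≡.refl _ = triple {x} n≡
  ...   | tri> _ _ y<x    = doubles y<x λ i → ≡.trans (n≡ i)
            (≡.cong suc (Perm.↭-length (Perm.filter-↭ (Fin._≟ i) (Perm.swap x y Perm.refl))))

  -- What the determinant computation needs from either profile. `A₂∈` admits A₂ = B₁, the middle
  -- column of a triple.
  record Separated (A₁ A₂ B₁ B₂ : Fin N) : Set where
    field
      A₁≢B₁       : A₁ ≢ B₁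
      A₂∈         : A₂ ∈ B₁ ∷ others A₁ B₁
      B₂∈         : B₂ ∈ others A₁ B₁
      residues-A  : residue A₁ ≡ residue A₂
      residues-B  : residue B₁ ≡ residue B₂
      A₁>A₂       : β A₁ > β A₂
      B₁>B₂       : β B₁ > β B₂
      b-S-↭       : map residue (others A₁ B₁) ↭ descending t

  private
    others-↭ : ∀ {A B} → A ≢ B → (∀ i → ∃[ j ] (j ∈ others A B × residue j ≡ i)) →
               map residue (others A B) ↭ descending t
    others-↭ {A} {B} A≢B cover = unique-⊆-length⇒↭ (unique-descending t)
      (λ {i} _ → let j , j∈ , rj = cover i in ≡.subst (_∈ map residue (others A B)) rj (∈.∈-map⁺ residue j∈))
      (ℕ.≤-reflexive (≡.trans (List.length-map residue (others A B)) (≡.trans length-others (≡.sym (length-descending t)))))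
      where
      length-others : length (others A B) ≡ t
      length-others = ℕ.+-cancelˡ-≡ 2 _ _ (≡.trans (≡.sym (Perm.↭-length (allFin-↭-others A≢B)))
        (≡.trans (List.length-tabulate {n = N} id) (ℕ.+-comm t 2)))

    elsewhere : ∀ {A B} → (∀ i → n i ≢ 0) → ∀ {i} → i ≢ residue A → i ≢ residue B → ∃[ j ] (j ∈ others A B × residue j ≡ i)
    elsewhere n≢0 {i} i≢A i≢B with j , rj ← occupied (n≢0 i) =
      j , ∈-others (λ { ≡.refl → i≢A (≡.sym rj) }) (λ { ≡.refl → i≢B (≡.sym rj) }) , rj

  -- Removing the columns A₁ and B₁ empties no class, since A₂ and B₂, or R for a triple, stay
  -- behind. The t remaining columns thus meet all t classes, each exactly once.
  separated : (∀ i → n i ≢ 0) → ∀ {A₁ A₂ B₁ B₂} → Pairs A₁ A₂ B₁ B₂ → Separated A₁ A₂ B₁ B₂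
  separated n≢0 {A₁} {A₂} {B₁} {B₂} (twoDoubles rA rB rA<rB _ _ _ rA₁ rA₂ A₁>A₂ rB₁ rB₂ B₁>B₂) = record
    { A₁≢B₁ = distinct rA₁ rB₁ ; A₂∈ = there A₂∈ ; B₂∈ = B₂∈
    ; residues-A = ≡.trans rA₁ (≡.sym rA₂) ; residues-B = ≡.trans rB₁ (≡.sym rB₂)
    ; A₁>A₂ = A₁>A₂ ; B₁>B₂ = B₁>B₂
    ; b-S-↭ = others-↭ (distinct rA₁ rB₁) cover
    }
    where
    distinct : ∀ {j k} → residue j ≡ rA → residue k ≡ rB → j ≢ k
    distinct rj rk ≡.refl = Fin.<⇒≢ rA<rB (≡.trans (≡.sym rj) rk)
    A₂∈ : A₂ ∈ others A₁ B₁
    A₂∈ = ∈-others (β-reflects A₁>A₂ ∘ ≡.sym) (distinct rA₂ rB₁)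
    B₂∈ : B₂ ∈ others A₁ B₁
    B₂∈ = ∈-others (distinct rA₁ rB₂ ∘ ≡.sym) (β-reflects B₁>B₂ ∘ ≡.sym)
    cover : ∀ i → ∃[ j ] (j ∈ others A₁ B₁ × residue j ≡ i)
    cover i with i Fin.≟ rA | i Fin.≟ rB
    ... | yes ≡.refl | _          = A₂ , A₂∈ , rA₂
    ... | no _       | yes ≡.refl = B₂ , B₂∈ , rB₂
    ... | no i≢rA    | no i≢rB    = elsewhere n≢0 (λ eq → i≢rA (≡.trans eq rA₁)) (λ eq → i≢rB (≡.trans eq rB₁))
  separated n≢0 {P} {Q} {_} {R} (oneTriple r _ _ rP rQ rR P>Q Q>R) = record
    { A₁≢B₁ = β-reflects P>Q ; A₂∈ = here ≡.refl ; B₂∈ = R∈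
    ; residues-A = ≡.trans rP (≡.sym rQ) ; residues-B = ≡.trans rQ (≡.sym rR)
    ; A₁>A₂ = P>Q ; B₁>B₂ = Q>R
    ; b-S-↭ = others-↭ (β-reflects P>Q) cover
    }
    where
    R∈ : R ∈ others P Q
    R∈ = ∈-others (β-reflects (ℕ.<-trans Q>R P>Q) ∘ ≡.sym) (β-reflects Q>R ∘ ≡.sym)
    cover : ∀ i → ∃[ j ] (j ∈ others P Q × residue j ≡ i)
    cover i with i Fin.≟ r
    ... | yes ≡.refl = R , R∈ , rR
    ... | no i≢r     = elsewhere n≢0 (λ eq → i≢r (≡.trans eq rP)) (λ eq → i≢r (≡.trans eq rQ))

-- Evaluation of the specialised Schur polynomial

betas-allFin : ∀ {n} (lam : Vec ℕ n) {c ℓ₁ ℓ₂} (F : HeytingField c ℓ₁ ℓ₂) →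
               Bialternant.betas F lam ≡ map (λ j → lookup lam j ℕ.+ (n ∸ suc (toℕ j))) (allFin n)
betas-allFin []                F = ≡.refl
betas-allFin {suc n} (a ∷ lam) F = ≡.cong (a ℕ.+ n ∷_) (≡.trans (betas-allFin lam F)
  (≡.trans (List.map-tabulate id _) (≡.sym (List.map-tabulate Fin.suc _))))

module Evaluation {c ℓ₁ ℓ₂} (F : HeytingField c ℓ₁ ℓ₂) (t : ℕ) .{{_ : NonZero t}} (2≤t : 2 ≤ t)
                  (lam : Vec ℕ (t ℕ.+ 2)) (partition : IsPartition lam)
                  (ζ : HeytingField.Carrier F) (isPrimitive : OverField.IsPrimitiveRoot F t ζ) where

  open CommutativeRing (Bialternant.ring F)
  open OverField F
  open HeytingField F using (_#_)
  open Exp semiring using (^-congʳ)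
  open IntegerCoefficients (Bialternant.ring F)
  open Alternants (Bialternant.ring F)
  open PermutationSigns (Bialternant.ring F)
  open Bialternant F hiding (ring)
  open LaurentPolynomials F
  open RootsOfUnity F t ζ isPrimitive
  open Hyperbolics F
  open SetoidReasoning setoid
  open BetaSet t lam
  open BetaSetProperties t lam partition

  -- The inverse of z is a free argument `y`, so the same expression can be treated as a Laurent
  -- polynomial and evaluated at integers.
  Schur : Carrier → Carrier → Carrier
  Schur z y = schur lam (specialization z y)

  columnDet : Carrier → Carrier → List (Fin N) → Carrier
  columnDet z y js = det (y ∷ z ∷ roots) (map (monomial ∘ β) js)

  schur-alternant : ∀ z y → columnDet z y (allFin N) ≈ Schur z y * vandermonde (points (specialization z y))
  schur-alternant z y = begin
    det (y ∷ z ∷ roots) (map (monomial ∘ β) (allFin N))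
      ≡⟨ ≡.cong₂ det (≡.sym (points-specialization z y))
           (≡.trans (List.map-∘ (allFin N)) (≡.cong (map monomial) (≡.sym (betas-allFin lam F)))) ⟩
    det (points (specialization z y)) (map monomial (betas lam))
      ≈⟨ bialternant lam partition (specialization z y) ⟩
    Schur z y * vandermonde (points (specialization z y)) ∎

  schur-laurent : Laurent Schur
  schur-laurent = laurent-resp (λ z y → reflexive (≡.cong (schur lam) (specialized z y)))
    (laurent-schur lam (VecAll.++⁺ {xs = constants} (VecAll.tabulate⁺ (λ i → laurent-const (power i)))
      (laurent-z ∷ laurent-z⁻¹ ∷ [])))
    where
    constants : Vec (Carrier → Carrier → Carrier) t
    constants = Vec.tabulate (λ i _ _ → power i)
    specialized : ∀ z y → evaluate (constants Vec.++ (λ z _ → z) ∷ (λ _ y → y) ∷ []) z y ≡ specialization z y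
    specialized z y = ≡.trans (Vec.map-++ (λ g → g z y) constants _)
      (≡.cong (Vec._++ z ∷ y ∷ []) (≡.sym (Vec.tabulate-∘ (λ g → g z y) (λ i _ _ → power i))))

  -- The Vandermonde determinant cannot be cancelled at every z, since it is 0 where
  -- z ^ t = 1 or z = z⁻¹. It is invertible at the integers z ≥ 2, and these suffice
  -- to show that a Laurent polynomial is 0.
  schur-vanishes : CharacteristicZero → (∀ z y → z * y ≈ 1# → Schur z y * vandermonde (points (specialization z y)) ≈ 0#) →
                   ∀ z y → z * y ≈ 1# → Schur z y ≈ 0#
  schur-vanishes char0 product≈0 = vanishing-laurent char0 schur-laurent λ j 2≤j y jy≈1 →
    unit-cancel-0 (unit-resp (sym (vandermonde-specialization 2≤t (j · 1#) y))
      (unit-* (unit-block char0 j y 2≤j jy≈1 t (ℕ.<⇒≤ 2≤t)) unit-residueDet))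
    (trans (*-comm _ _) (product≈0 (j · 1#) y jy≈1))

  empty-class : CharacteristicZero → ∀ {i} → n i ≡ 0 → ∀ z y → z * y ≈ 1# → Schur z y ≈ 0#
  empty-class char0 {i} n≡0 = schur-vanishes char0 λ z y _ → begin
    Schur z y * vandermonde (points (specialization z y))
      ≈⟨ schur-alternant z y ⟨
    columnDet z y (allFin N)
      ≡⟨ ≡.cong (det (y ∷ z ∷ roots)) (List.map-∘ (allFin N)) ⟩
    det (y ∷ z ∷ roots) (map monomial (map β (allFin N)))
      ≈⟨ det-missing-residue y z i _ (All.map⁺ (All.universal avoids (allFin N))) ⟩
    0# ∎
    where
    avoids : ∀ j → residue j ≢ i
    avoids j rj = ℕ.n≮0 (≡.subst (0 <_) n≡0 (List.filter-some (λ j → residue j Fin.≟ i) (Any.map (λ { ≡.refl → rj }) (∈.∈-allFin j))))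

  module _ {A₁ A₂ B₁ B₂ : Fin N} (sep : Separated A₁ A₂ B₁ B₂) where

    open Separated sep
    open Invariants A₁ A₂ B₁ B₂

    -- The sign exponents of three rearrangements: bringing A₁ and B₁ to the front, and passing from
    -- the word b_S to `descending t`, which has C(t,2) inversions of its own.
    inversions : ℕ
    inversions = inv (A₁ ∷ B₁ ∷ others A₁ B₁) ℕ.+ (inv b-S ℕ.+ t C 2)

    -- Both blocks come with the same alternant at the roots. Cancelling this unit instead of the
    -- whole Vandermonde determinant keeps the identity valid at every z.
    schur-blocks : ∀ z y → z * y ≈ 1# →
                   Schur z y * block y z (suc t) 1 t 0 ≈ sign inversions * block y z (β A₁) (β A₂) (β B₁) (β B₂)
    schur-blocks z y zy≈1 = unit-cancel unit-residueDet (begin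
      D * (Schur z y * block y z (suc t) 1 t 0)
        ≈⟨ solve 3 (λ d s k → d :* (s :* k) := s :* (k :* d)) refl _ _ _ ⟩
      Schur z y * (block y z (suc t) 1 t 0 * D)
        ≈⟨ *-congˡ (vandermonde-specialization 2≤t z y) ⟨
      Schur z y * vandermonde (points (specialization z y))
        ≈⟨ schur-alternant z y ⟨
      columnDet z y (allFin N)
        ≈⟨ signed-solve (alternating-map (monomial ∘ β) (det-alternating (y ∷ z ∷ roots))) (allFin-↭-others A₁≢B₁) ⟩
      sign (inv (allFin N) ℕ.+ e₁) * columnDet z y (A₁ ∷ B₁ ∷ others A₁ B₁)
        ≡⟨ ≡.cong₂ (λ k fs → sign (k ℕ.+ e₁) * det (y ∷ z ∷ roots) (monomial (β A₁) ∷ monomial (β B₁) ∷ fs))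
             (inv-sorted (sorted-allFin N)) (List.map-∘ (others A₁ B₁)) ⟩
      sign e₁ * det (y ∷ z ∷ roots) (map monomial (β A₁ ∷ β B₁ ∷ map β (others A₁ B₁)))
        ≈⟨ *-congˡ (det-two-pairs y z (∈.∈-map⁺ β A₂∈) (∈.∈-map⁺ β B₂∈) residues-A residues-B) ⟩
      sign e₁ * (K * residueDet (map (_mod t) (map β (others A₁ B₁))))
        ≡⟨ ≡.cong (λ rs → sign e₁ * (K * residueDet rs)) (≡.sym (List.map-∘ (others A₁ B₁))) ⟩
      sign e₁ * (K * residueDet b-S)
        ≈⟨ *-congˡ (*-congˡ (signed-solve residueDet-alternating b-S-↭)) ⟩
      sign e₁ * (K * (sign (inv b-S ℕ.+ inv (descending t)) * D))
        ≡⟨ ≡.cong (λ k → sign e₁ * (K * (sign (inv b-S ℕ.+ k) * D))) (inv-descending t) ⟩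
      sign e₁ * (K * (sign e₂ * D))
        ≈⟨ solve 4 (λ p k q d → p :* (k :* (q :* d)) := d :* (p :* q :* k)) refl _ _ _ _ ⟩
      D * (sign e₁ * sign e₂ * K)
        ≈⟨ *-congˡ (*-congʳ (sign-+ e₁ e₂)) ⟨
      D * (sign inversions * K) ∎)
      where
      e₁ = inv (A₁ ∷ B₁ ∷ others A₁ B₁)
      e₂ = inv b-S ℕ.+ t C 2
      K = block y z (β A₁) (β A₂) (β B₁) (β B₂)
      D = residueDet (descending t)

    -- Equal sums make the first factor of `factor-block` zero. This annihilates only the product
    -- with the Vandermonde determinant, hence the appeal to `schur-vanishes`.
    equal-sums : CharacteristicZero → d̃₃ ≡ 0ℤ → ∀ z y → z * y ≈ 1# → Schur z y ≈ 0#
    equal-sums char0 d̃₃≡0 = schur-vanishes char0 λ z y zy≈1 → begin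
      Schur z y * vandermonde (points (specialization z y))
        ≈⟨ *-congˡ (vandermonde-specialization 2≤t z y) ⟩
      Schur z y * (block y z (suc t) 1 t 0 * residueDet (descending t))
        ≈⟨ *-assoc _ _ _ ⟨
      Schur z y * block y z (suc t) 1 t 0 * residueDet (descending t)
        ≈⟨ *-congʳ (trans (schur-blocks z y zy≈1) (*-congˡ (factor-block zy≈1 (β A₁) (β A₂) (β B₁) (β B₂)))) ⟩
      sign inversions * ((y ^ (β B₁ ℕ.+ β B₂) - y ^ (β A₁ ℕ.+ β A₂)) * _) * residueDet (descending t)
        ≈⟨ *-congʳ (*-congˡ (*-congʳ (trans (+-congˡ (-‿cong (^-congʳ y sums))) (-‿inverseʳ _)))) ⟩
      sign inversions * (0# * _) * residueDet (descending t)
        ≈⟨ solve 3 (λ s k d → s :* (con 0ℤ :* k) :* d := con 0ℤ) refl _ _ _ ⟩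
      0# ∎
      where
      sums : β A₁ ℕ.+ β A₂ ≡ β B₁ ℕ.+ β B₂
      sums = ℤ.+-injective (ℤ.i-j≡0⇒i≡j (+ (β A₁ ℕ.+ β A₂)) (+ (β B₁ ℕ.+ β B₂)) d̃₃≡0)

    private
      sgn-greater : ∀ {k l} → l < k → sgn (+ k ℤ.- + l) ≡ 1ℤ
      sgn-greater {k} {l} l<k with d , ≡.refl ← ℕ.m≤n⇒∃[o]m+o≡n l<k =
        ≡.cong sgn (≡.trans (ℤ.m-n≡m⊖n k l) (⊖-greater l d))

      sgn-less : ∀ {k l} → k < l → sgn (+ k ℤ.- + l) ≡ -1ℤ
      sgn-less {k} {l} k<l with d , ≡.refl ← ℕ.m≤n⇒∃[o]m+o≡n k<l =
        ≡.cong sgn (≡.trans (ℤ.m-n≡m⊖n k l) (⊖-less k d))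

      sign-double : ∀ k l → sign (k ℕ.+ k ℕ.+ l) ≈ sign l
      sign-double k l = trans (sign-+ (k ℕ.+ k) l) (trans (*-congʳ (trans (sign-+ k k) (sign-square k))) (*-identityˡ _))

      -- β decreases along the columns, so the sign of a₁ - b₁ tells which of A₁ and B₁ comes first,
      -- and that is exactly where the two inversion counts differ by 1.
      sign-columns : sign (toℕ A₁ ℕ.+ toℕ B₁) * ⟦ sgn (+ β A₁ ℤ.- + β B₁) ⟧ℤ ≈ - sign (inv (A₁ ∷ B₁ ∷ others A₁ B₁))
      sign-columns with Fin.<-cmp A₁ B₁
      ... | tri< A<B _ _ rewrite sgn-greater (β-antitone A<B) | ≡.sym (inv-others-< A<B) = *-identityʳ _
      ... | tri≈ _ A≡B _ = contradiction A≡B A₁≢B₁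
      ... | tri> _ _ B<A rewrite sgn-less (β-antitone B<A) | ≡.sym (inv-others-> B<A) =
        solve 1 (λ a → a :* (:- con 1ℤ) := :- a) refl _

    ε-inversions : fromℤ ε ≈ sign inversions * ⟦ sgn d̃₃ ⟧ℤ
    ε-inversions = begin
      fromℤ ε
        ≈⟨ fromℤ≈⟦⟧ ε ⟩
      ⟦ ε ⟧ℤ
        ≈⟨ trans (*-homo (p₁ ℤ.* p₂ ℤ.* p₃) (sgn d̃₃)) (*-congʳ (trans (*-homo (p₁ ℤ.* p₂) p₃)
             (*-congʳ (trans (*-homo p₁ p₂) (*-cong (⟦-1^⟧ (t ℕ.+ (suc N C 2))) (⟦-1^⟧ (column A₁ ℕ.+ column B₁ ℕ.+ inv b-S))))))) ⟩
      sign (t ℕ.+ (suc N C 2)) * sign (column A₁ ℕ.+ column B₁ ℕ.+ inv b-S) * ⟦ p₃ ⟧ℤ * s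
        ≈⟨ *-congʳ (*-congʳ (*-cong
             (trans (reflexive (≡.cong sign (t+[t+3]C2 t))) (-‿cong (sign-double (t ℕ.+ t ℕ.+ 1) (t C 2))))
             (trans (sign-+ (column A₁ ℕ.+ column B₁) (inv b-S)) (*-congʳ column-signs)))) ⟩
      - sign (t C 2) * (sign (toℕ A₁ ℕ.+ toℕ B₁) * sign (inv b-S)) * ⟦ p₃ ⟧ℤ * s
        ≈⟨ solve 5 (λ c a b p s → (:- c) :* (a :* b) :* p :* s := (:- (a :* p)) :* (b :* c) :* s) refl _ _ _ _ _ ⟩
      - (sign (toℕ A₁ ℕ.+ toℕ B₁) * ⟦ p₃ ⟧ℤ) * (sign (inv b-S) * sign (t C 2)) * s
        ≈⟨ *-congʳ (*-cong (trans (-‿cong sign-columns) (solve 1 (λ a → :- (:- a) := a) refl _)) (sym (sign-+ (inv b-S) (t C 2)))) ⟩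
      sign (inv (A₁ ∷ B₁ ∷ others A₁ B₁)) * sign (inv b-S ℕ.+ t C 2) * s
        ≈⟨ *-congʳ (sign-+ (inv (A₁ ∷ B₁ ∷ others A₁ B₁)) (inv b-S ℕ.+ t C 2)) ⟨
      sign inversions * s ∎
      where
      p₁ p₂ p₃ : ℤ
      p₁ = -1ℤ ℤ.^ (t ℕ.+ (suc N C 2))
      p₂ = -1ℤ ℤ.^ (column A₁ ℕ.+ column B₁ ℕ.+ inv b-S)
      p₃ = sgn (+ β A₁ ℤ.- + β B₁)
      s = ⟦ sgn d̃₃ ⟧ℤ
      -- Columns count from 1 and `toℕ` from 0; the two shifts cancel in the sign.
      column-signs : sign (column A₁ ℕ.+ column B₁) ≈ sign (toℕ A₁ ℕ.+ toℕ B₁)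
      column-signs = trans (reflexive (≡.cong (sign ∘ suc) (ℕ.+-suc (toℕ A₁) (toℕ B₁)))) (solve 1 (λ a → :- (:- a) := a) refl _)

    ε≡±1 : d̃₃ ≢ 0ℤ → ε ≡ 1ℤ ⊎ ε ≡ -1ℤ
    ε≡±1 d̃₃≢0 = *-cases (*-cases (*-cases (-1^-cases (t ℕ.+ (suc N C 2))) (-1^-cases (column A₁ ℕ.+ column B₁ ℕ.+ inv b-S))) sgn-difference) (sgn-cases d̃₃≢0)
      where
      sgn-difference : sgn (+ β A₁ ℤ.- + β B₁) ≡ 1ℤ ⊎ sgn (+ β A₁ ℤ.- + β B₁) ≡ -1ℤ
      sgn-difference with Fin.<-cmp A₁ B₁
      ... | tri< A<B _ _ = inj₁ (sgn-greater (β-antitone A<B))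
      ... | tri≈ _ A≡B _ = contradiction A≡B A₁≢B₁
      ... | tri> _ _ B<A = inj₂ (sgn-less (β-antitone B<A))

    hyperbolic-formula : (char0 : CharacteristicZero) →
      ∀ z y → z * y ≈ 1# → ∀ w (w#0 : w # 0#) → w ^ 2 ≈ z →
      let open Hyperbolic char0 w#0 in
      (den#0 : denominator t # 0#) →
      Schur z y ≈ fromℤ ε * ((sinhHalf d₁ * sinhHalf d₂ * sinhHalf d₃) * recip den#0)
    hyperbolic-formula char0 z y zy≈1 w w#0 w²≈z den#0 = begin
      Schur z y
        ≈⟨ *-identityʳ _ ⟨
      Schur z y * 1#
        ≈⟨ *-congˡ (*-recip den#0) ⟨
      Schur z y * (denominator t * recip den#0)
        ≈⟨ *-assoc _ _ _ ⟨
      Schur z y * denominator t * recip den#0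
        ≈⟨ *-congʳ (begin
             -- Numerator and denominator both consist of three sinh factors, so the same h³, with h
             -- = 1/2, appears on both sides.
             Schur z y * ((S t * h) * ((S t * h) * 1#) * (S 2 * h))
               ≈⟨ solve 4 (λ f a b h → f :* ((a :* h) :* ((a :* h) :* con 1ℤ) :* (b :* h))
                    := f :* (con 1ℤ :* (a :* a :* b)) :* (h :* h :* h)) refl _ _ _ _ ⟩
             Schur z y * (1# * (S t * S t * S 2)) * (h * h * h)
               ≈⟨ *-congʳ (*-congˡ base) ⟨
             Schur z y * block y z (suc t) 1 t 0 * (h * h * h)
               ≈⟨ *-congʳ (schur-blocks z y zy≈1) ⟩
             sign inversions * block y z (β A₁) (β A₂) (β B₁) (β B₂) * (h * h * h)
               ≈⟨ *-congʳ (*-congˡ (trans (Block-cong′ (β A₁) (β A₂) (β B₁) (β B₂))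
                    (hyperbolic-block wv≈1 (ℕ.<⇒≤ A₁>A₂) (ℕ.<⇒≤ B₁>B₂)))) ⟩
             sign inversions * (⟦ sgn d̃₃ ⟧ℤ * (S d₁ * S d₂ * S d₃)) * (h * h * h)
               ≈⟨ solve 6 (λ e s a b c h → e :* (s :* (a :* b :* c)) :* (h :* h :* h)
                    := e :* s :* ((a :* h) :* (b :* h) :* (c :* h))) refl _ _ _ _ _ _ ⟩
             sign inversions * ⟦ sgn d̃₃ ⟧ℤ * (sinhHalf d₁ * sinhHalf d₂ * sinhHalf d₃)
               ≈⟨ *-congʳ ε-inversions ⟨
             fromℤ ε * (sinhHalf d₁ * sinhHalf d₂ * sinhHalf d₃) ∎) ⟩
      fromℤ ε * (sinhHalf d₁ * sinhHalf d₂ * sinhHalf d₃) * recip den#0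
        ≈⟨ *-assoc _ _ _ ⟩
      fromℤ ε * ((sinhHalf d₁ * sinhHalf d₂ * sinhHalf d₃) * recip den#0) ∎
      where
      open Hyperbolic char0 w#0
      v = recip w#0
      h = recip (char0 1)
      S = sinhDouble w v
      wv≈1 : w * v ≈ 1#
      wv≈1 = *-recip w#0
      y≈v² : y ≈ v ^ 2
      y≈v² = unit-cancel {z} (y , zy≈1) (trans zy≈1 (sym (begin
        z * v ^ 2       ≈⟨ *-congʳ w²≈z ⟨
        w ^ 2 * v ^ 2   ≈⟨ power-inverse wv≈1 2 ⟩
        1#              ∎)))
      Block-cong′ : ∀ a₁ a₂ b₁ b₂ → block y z a₁ a₂ b₁ b₂ ≈ block (v ^ 2) (w ^ 2) a₁ a₂ b₁ b₂
      Block-cong′ = block-cong y≈v² (sym w²≈z)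
      -- For λ = 0 the invariants are d₁ = d₂ = t and d̃₃ = (t + 2) - t = 2, which is where the
      -- denominator of the formula comes from.
      d̃ : + (suc t ℕ.+ 1) ℤ.- + (t ℕ.+ 0) ≡ + 2
      d̃ = ≡.trans (ℤ.m-n≡m⊖n (suc t ℕ.+ 1) (t ℕ.+ 0))
        (≡.trans (≡.cong₂ ℤ._⊖_ (ℕ.+-comm (suc t) 1) (ℕ.+-identityʳ t))
          (≡.trans (≡.cong (ℤ._⊖ t) (≡.cong suc (ℕ.+-comm 1 t))) (⊖-greater t 1)))
      base : block y z (suc t) 1 t 0 ≈ 1# * (S t * S t * S 2)
      base = trans (Block-cong′ (suc t) 1 t 0) (trans (hyperbolic-block wv≈1 {suc t} {1} {t} {0} (s≤s z≤n) z≤n)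
        (reflexive (≡.cong (λ i → ⟦ sgn i ⟧ℤ * (S t * S t * S ℤ.∣ i ∣)) d̃)))

theorem3p1 : ∀ {c ℓ₁ ℓ₂} (F : HeytingField c ℓ₁ ℓ₂) →
    let open HeytingField F in
    let open OverField F in
    (char0 : CharacteristicZero) →
    ∀ (t : ℕ) .{{_ : NonZero t}} → 2 ≤ t →
    ∀ (lam : Vec ℕ (t ℕ.+ 2)) → IsPartition lam →
    ∀ (ζ : Carrier) → IsPrimitiveRoot t ζ →
    let open BetaSet t lam in
    ((∃[ i ] n i ≡ 0) → ∀ z (z#0 : z # 0#) → Φ t lam ζ z z#0 ≈ 0#)
    ×
    ((∀ i → n i ≢ 0) →
    (∃[ A₁ ] ∃[ A₂ ] ∃[ B₁ ] ∃[ B₂ ] Pairs A₁ A₂ B₁ B₂)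
    ×
    (∀ A₁ A₂ B₁ B₂ → Pairs A₁ A₂ B₁ B₂ →
    let open Invariants A₁ A₂ B₁ B₂ in
    (d̃₃ ≡ 0ℤ → ∀ z (z#0 : z # 0#) → Φ t lam ζ z z#0 ≈ 0#)
    ×
    (d̃₃ ≢ 0ℤ →
    (ε ≡ 1ℤ ⊎ ε ≡ -1ℤ)
    ×
    (∀ z (z#0 : z # 0#) w (w#0 : w # 0#) → w ^ 2 ≈ z →
    let open Hyperbolic char0 w#0 in
    (den#0 : denominator t # 0#) →
    Φ t lam ζ z z#0
    ≈ fromℤ ε
    * ((sinhHalf d₁
    * sinhHalf d₂
    * sinhHalf d₃)
    * recip den#0)))))
theorem3p1 F char0 t 2≤t lam partition ζ isPrimitive =
    (λ (i , n≡0) z z#0 → empty-class char0 n≡0 z _ (*-recip z#0))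
  , λ n≢0 →
      pairs n≢0
    , λ A₁ A₂ B₁ B₂ P → let sep = separated n≢0 P in
          (λ d̃₃≡0 z z#0 → equal-sums sep char0 d̃₃≡0 z _ (*-recip z#0))
        , λ d̃₃≢0 →
            ε≡±1 sep d̃₃≢0
          , λ z z#0 w w#0 w²≈z den#0 → hyperbolic-formula sep char0 z _ (*-recip z#0) w w#0 w²≈z den#0
  where
  open LaurentPolynomials F using (*-recip)
  open BetaSetProperties t lam partition
  open Evaluation F t 2≤t lam partition ζ isPrimitive
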